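{- (i) Let $p$ be an odd prime number, $m\ge2$ and $n=2l\ge4$. If $l$ is even: \[w_{n+2}^{\overline{1}}(\mathbb{Z}/p^{m}\mathbb{Z})=\frac{p^{(m-1)(n-1)}(p^{l+1}-1)(p^{l}-1)}{p^{2}-1},\] \[w_{n+2}^{\overline{ -1}}(\mathbb{Z}/p^{m}\mathbb{Z})=p^{(m-1)(n-1)}\left(\frac{(p^{l+1}-1)(p^{l}-1)}{p^{2}-1}+p^{l}\right)+\frac{p^{(m-1)(n-1-l)}-1}{p^{n-1-l}-1}\,p^{ml-1}(p-1).\] If $l$ is odd: \[w_{n+2}^{\overline{1}}(\mathbb{Z}/p^{m}\mathbb{Z})=p^{(m-1)(n-1)}\left(\frac{(p^{l+1}-1)(p^{l}-1)}{p^{2}-1}+p^{l}\right)+\frac{p^{(m-1)(n-1-l)}-1}{p^{n-1-l}-1}\,p^{ml-1}(p-1),\] \[w_{n+2}^{\overline{ -1}}(\mathbb{Z}/p^{m}\mathbb{Z})=\frac{p^{(m-1)(n-1)}(p^{l+1}-1)(p^{l}-1)}{p^{2}-1}.\] (ii) Let $m\ge3$ and $n=2l\ge4$. If $l$ is even: \[w_{n+2}^{\overline{1}}(\mathbb{Z}/2^{m}\mathbb{Z})=2^{(m-2)(n-1)}\frac{4^{n}-2^{n}}{3},\qquad w_{n+2}^{\overline{ -1}}(\mathbb{Z}/2^{m}\mathbb{Z})=2^{(m-2)(n-1)}\frac{4^{n}+2^{n+1}}{3}+\frac{2^{(m-2)(n-1-l)}-1}{2^{n-1-l}-1}\,2^{ml-1}.\]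 If $l$ is odd: \[w_{n+2}^{\overline{1}}(\mathbb{Z}/2^{m}\mathbb{Z})=2^{(m-2)(n-1)}\frac{4^{n}+2^{n+1}}{3}+\frac{2^{(m-2)(n-1-l)}-1}{2^{n-1-l}-1}\,2^{ml-1},\qquad w_{n+2}^{\overline{ -1}}(\mathbb{Z}/2^{m}\mathbb{Z})=2^{(m-2)(n-1)}\frac{4^{n}-2^{n}}{3}.\]
   Context: For a commutative unitary ring $A$ and $(a_1,\dots,a_n)\in A^n$, $M_{n}(a_1,\ldots,a_n):=\begin{pmatrix} a_{n} & -1_{A} \\ 1_{A} & 0_{A}\end{pmatrix}\cdots\begin{pmatrix} a_{1} & -1_{A} \\ 1_{A} & 0_{A}\end{pmatrix}$. For a unit $u$ of $A$, $w_{n}^{u}(A)$ is the number of $(a_1,\dots,a_n)\in A^n$ with $M_n(a_1,\dots,a_n)=\begin{pmatrix} u & 0_A\\ 0_A & u^{ -1}\end{pmatrix}$. For an integer $a$, $\overline{a}$ denotes its class modulo the relevant modulus. -}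

module Defs where

open import Data.Nat as ℕ using (ℕ; zero; suc; NonZero)
open import Data.Nat.Properties as ℕP using ()
open import Data.Integer as ℤ using (ℤ; +_; -_; _%ℕ_)
open import Data.Fin using (Fin; toℕ)
open import Data.Vec using (Vec; []; _∷_)
open import Data.List using (List; []; _∷_; map; concatMap; length; filter)
open import Data.Product using (_×_; _,_)
open import Relation.Binary.PropositionalEquality using (_≡_)
open import Relation.Nullary using (Dec)
open import Relation.Nullary.Decidable using (_×-dec_)

-- 2x2 matrices over ℤ, entries (a , b , c , d) = [[a , b] , [c , d]]
Mat : Set
Mat = ℤ × ℤ × ℤ × ℤ

_⊗_ : Mat → Mat → Mat
(a , b , c , d) ⊗ (a' , b' , c' , d') =
  (a ℤ.* a' ℤ.+ b ℤ.* c' , a ℤ.* b' ℤ.+ b ℤ.* d' ,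
   c ℤ.* a' ℤ.+ d ℤ.* c' , c ℤ.* b' ℤ.+ d ℤ.* d')

I₂ : Mat
I₂ = (+ 1 , + 0 , + 0 , + 1)

Aₘ : ℤ → Mat
Aₘ a = (a , - (+ 1) , + 1 , + 0)

M' : ∀ {k} → Mat → Vec ℤ k → Mat
M' acc [] = acc
M' acc (a ∷ as) = M' (Aₘ a ⊗ acc) as

Mₙ : ∀ {k} → Vec ℤ k → Mat
Mₙ = M' I₂

allVecs : (N k : ℕ) → List (Vec (Fin N) k)
allVecs N zero = [] ∷ []
allVecs N (suc k) =
  concatMap (λ i → map (i ∷_) (allVecs N k)) (Data.List.allFin N)
  where import Data.List

toℤvec : ∀ {N k} → Vec (Fin N) k → Vec ℤ k
toℤvec [] = []
toℤvec (i ∷ is) = + toℕ i ∷ toℤvec is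

infix 4 _≡[mod_]_
_≡[mod_]_ : ℤ → (N : ℕ) → .{{NonZero N}} → ℤ → Set
x ≡[mod N ] y = (x ℤ.- y) %ℕ N ≡ 0

≡[mod]? : (x : ℤ) (N : ℕ) .{{_ : NonZero N}} (y : ℤ) → Dec (x ≡[mod N ] y)
≡[mod]? x N y = ((x ℤ.- y) %ℕ N) ℕ.≟ 0

IsDiagMod : (N : ℕ) .{{_ : NonZero N}} (u v : ℤ) → Mat → Set
IsDiagMod N u v (a , b , c , d) =
  (a ≡[mod N ] u) × (b ≡[mod N ] (+ 0)) × (c ≡[mod N ] (+ 0)) × (d ≡[mod N ] v)

IsDiagMod? : (N : ℕ) .{{_ : NonZero N}} (u v : ℤ) (M : Mat) → Dec (IsDiagMod N u v M)
IsDiagMod? N u v (a , b , c , d) =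
  ≡[mod]? a N u ×-dec ≡[mod]? b N (+ 0) ×-dec ≡[mod]? c N (+ 0) ×-dec ≡[mod]? d N v

-- w_k^u(ℤ/Nℤ), where u is given by an integer representative and
-- uinv by a representative of its inverse modulo N:
-- number of (a_1,…,a_k) ∈ (ℤ/Nℤ)^k with M_k(a_1,…,a_k) = diag(u , u⁻¹).
-- ℤ/Nℤ is represented by the residues 0,…,N-1 (Fin N).
w : (N : ℕ) .{{_ : NonZero N}} (k : ℕ) (u uinv : ℤ) → ℕ
w N k u uinv =
  length (filter (λ as → IsDiagMod? N u uinv (Mₙ (toℤvec as))) (allVecs N k))

-- w_k^{1̄} and w_k^{-1̄} (both units are self-inverse)
w⁺ : (N : ℕ) .{{_ : NonZero N}} (k : ℕ) → ℕ
w⁺ N k = w N k (+ 1) (+ 1)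

w⁻ : (N : ℕ) .{{_ : NonZero N}} (k : ℕ) → ℕ
w⁻ N k = w N k (- (+ 1)) (- (+ 1))

{-# OPTIONS --safe #-}

-- Solving the last two factors out of M = diag(ε, ε) leaves the condition K_n(a₁,…,a_n) = −ε on
-- the top-left entry (a continuant), so w_{n+2}^ε = F_n(ε) := #{K_n = −ε}.
-- For q = p^m, Q = p^(m+1) and c ≢ 0 mod Q, the congruence bc ≡ t has p times fewer solutions
-- b mod Q when read modulo Q than when read modulo q.  Applying this to K_n = a_n K_{n−1} − K_{n−2},
-- the defect sits at K_{n−1} ≡ 0 mod Q, where a_{n−1} is determined by the earlier entries because
-- K_{n−2} ≡ ε mod q is a unit; hence for m ≥ 1
--   F_n^Q(ε) − p^(n−1) F_n^q(ε) = Q (F_{n−2}^Q(−ε) − p^(n−3) F_{n−2}^q(−ε)).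
-- Descending to n = 0 gives a linear recursion in m whose inhomogeneous term vanishes unless
-- ε = −(−1)^l.  Modulo p the same argument with q = 1 gives the initial value; for p = 2 the
-- classes of 1 and −1 only separate modulo 4, which is why that case starts at m = 2.
module Submission where

open import Defs
open import Data.Bool using (if_then_else_)
open import Data.Empty using (⊥-elim)
open import Data.Fin using (Fin; toℕ) renaming (zero to fzero; suc to fsuc)
open import Data.Integer as ℤ using (ℤ; +_; -[1+_]; -_; _%ℕ_)
open import Data.Integer.Divisibility.Signed using (divides; ∣ᵤ⇒∣; ∣⇒∣ᵤ; ∣m∣n⇒∣m+n; ∣n⇒∣m*n; *-cancelˡ-∣; *-monoʳ-∣) renaming (_∣_ to _∣ℤ_; _∣?_ to _∣ℤ?_; ∣-trans to ∣ℤ-trans; ∣-refl to ∣ℤ-refl)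
open import Data.Integer.DivMod using (a≡a%ℕn+[a/ℕn]*n)
open import Data.Integer.Properties as ℤP using ()
open import Data.Integer.Tactic.RingSolver using () renaming (solve-∀ to ringℤ)
open import Data.List using (List; []; _∷_; map; concatMap; length; filter; tabulate)
open import Data.List.Properties using (length-++; filter-++)
open import Data.Nat using (ℕ; zero; suc; _+_; _*_; _∸_; _^_; _≤_; _<_; s≤s; z≤n; NonZero; nonTrivial⇒≢1; nonTrivial⇒n>1)
open import Data.Nat.Coprimality using (Coprime; coprime-Bézout)
open import Data.Nat.Divisibility using (_∣_; divides; ∣⇒≤; ∣1⇒≡1; n∣m⇒m%n≡0; ∣-refl; ∣-trans)
open import Data.Nat.GCD using (module Bézout)
open import Data.Nat.Primality using (Prime; prime⇒nonZero; prime⇒nonTrivial; prime⇒irreducible; prime[2]; ¬prime[0])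
open import Data.Nat.Properties
open import Data.Nat.Tactic.RingSolver using () renaming (solve-∀ to ringℕ)
open import Data.Product using (_×_; _,_; proj₁; proj₂; ∃; ∃₂)
open import Data.Sum using (inj₁; inj₂)
open import Data.Unit using (⊤; tt)
open import Data.Vec using ([]; _∷_)
open import Function using (_∘_)
open import Relation.Nullary using (¬_; Dec; yes; no; does)
open import Relation.Binary.PropositionalEquality using (_≡_; refl; sym; trans; cong; cong₂; subst; subst₂; module ≡-Reasoning)
open ≡-Reasoning

private variable
  U V : Set
  X Y : Set

-- Divisibility and indicators

comb₁ : ∀ {n e z} c → n ∣ℤ e → z ≡ c ℤ.* e → n ∣ℤ z
comb₁ c h refl = ∣n⇒∣m*n c h

comb₂ : ∀ {n e f z} c d → n ∣ℤ e → n ∣ℤ f → z ≡ c ℤ.* e ℤ.+ d ℤ.* f → n ∣ℤ z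
comb₂ c d h k refl = ∣m∣n⇒∣m+n (∣n⇒∣m*n c h) (∣n⇒∣m*n d k)

≡0⇒∣ : ∀ {n z} → z ≡ + 0 → n ∣ℤ z
≡0⇒∣ {n} refl = divides (+ 0) refl

ind : Dec U → ℕ
ind d = if does d then 1 else 0

ind-true : (d : Dec U) → U → ind d ≡ 1
ind-true (yes _) _ = refl
ind-true (no ¬p) p = ⊥-elim (¬p p)

ind-false : (d : Dec U) → ¬ U → ind d ≡ 0
ind-false (yes p) ¬p = ⊥-elim (¬p p)
ind-false (no _) _ = refl

ind-cong : (d : Dec U) (e : Dec V) → (U → V) → (V → U) → ind d ≡ ind e
ind-cong (yes p) e f g = sym (ind-true e (f p))
ind-cong (no ¬p) e f g = sym (ind-false e (¬p ∘ g))

opaque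
  δ : ℕ → ℤ → ℕ
  δ n z = ind (+ n ∣ℤ? z)

  δ-true : ∀ n z → + n ∣ℤ z → δ n z ≡ 1
  δ-true n z = ind-true (+ n ∣ℤ? z)

  δ-false : ∀ n z → ¬ + n ∣ℤ z → δ n z ≡ 0
  δ-false n z = ind-false (+ n ∣ℤ? z)

  δ-cong : ∀ m n y z → (+ m ∣ℤ y → + n ∣ℤ z) → (+ n ∣ℤ z → + m ∣ℤ y) → δ m y ≡ δ n z
  δ-cong m n y z = ind-cong (+ m ∣ℤ? y) (+ n ∣ℤ? z)

δ-mod : ∀ n y z → + n ∣ℤ (y ℤ.- z) → δ n y ≡ δ n z
δ-mod n y z h = δ-cong n n y z
  (λ k → comb₂ (+ 1) (- + 1) k h (lem y z))
  (λ k → comb₂ (+ 1) (+ 1) k h (lem′ y z))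
  where
  lem : ∀ y z → z ≡ + 1 ℤ.* y ℤ.+ (- + 1) ℤ.* (y ℤ.- z)
  lem = ringℤ
  lem′ : ∀ y z → y ≡ + 1 ℤ.* z ℤ.+ + 1 ℤ.* (y ℤ.- z)
  lem′ = ringℤ

-- Sums over residues

∑ : ℕ → (ℤ → ℕ) → ℕ
∑ zero f = 0
∑ (suc n) f = f (+ 0) + ∑ n (λ z → f (+ 1 ℤ.+ z))

Periodic : ℕ → (ℤ → ℕ) → Set
Periodic n f = ∀ z → f (+ n ℤ.+ z) ≡ f z

∑-cong : ∀ n {f g : ℤ → ℕ} → (∀ z → f z ≡ g z) → ∑ n f ≡ ∑ n g
∑-cong zero h = refl
∑-cong (suc n) h = cong₂ _+_ (h _) (∑-cong n (λ z → h _))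

∑-+ : ∀ n (f g : ℤ → ℕ) → ∑ n (λ z → f z + g z) ≡ ∑ n f + ∑ n g
∑-+ zero f g = refl
∑-+ (suc n) f g rewrite ∑-+ n (λ z → f (+ 1 ℤ.+ z)) (λ z → g (+ 1 ℤ.+ z)) =
  lem (f (+ 0)) (g (+ 0)) _ _
  where
  lem : ∀ a b c d → a + b + (c + d) ≡ a + c + (b + d)
  lem = ringℕ

∑-*ˡ : ∀ n c (f : ℤ → ℕ) → ∑ n (λ z → c * f z) ≡ c * ∑ n f
∑-*ˡ zero c f = sym (*-zeroʳ c)
∑-*ˡ (suc n) c f rewrite ∑-*ˡ n c (λ z → f (+ 1 ℤ.+ z)) = sym (*-distribˡ-+ c _ _)

∑-const : ∀ n c → ∑ n (λ _ → c) ≡ n * c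
∑-const zero c = refl
∑-const (suc n) c = cong (_+_ c) (∑-const n c)

∑-swap : ∀ m n (f : ℤ → ℤ → ℕ) → ∑ m (λ x → ∑ n (f x)) ≡ ∑ n (λ y → ∑ m (λ x → f x y))
∑-swap zero n f = sym (trans (∑-const n 0) (*-zeroʳ n))
∑-swap (suc m) n f = begin
  ∑ n (f (+ 0)) + ∑ m (λ x → ∑ n (f (+ 1 ℤ.+ x)))
    ≡⟨ cong (_+_ (∑ n (f (+ 0)))) (∑-swap m n (λ x → f (+ 1 ℤ.+ x))) ⟩
  ∑ n (f (+ 0)) + ∑ n (λ y → ∑ m (λ x → f (+ 1 ℤ.+ x) y))
    ≡⟨ ∑-+ n _ _ ⟨
  ∑ n (λ y → f (+ 0) y + ∑ m (λ x → f (+ 1 ℤ.+ x) y)) ∎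

∑-split : ∀ m n (f : ℤ → ℕ) → ∑ (m + n) f ≡ ∑ m f + ∑ n (λ z → f (+ m ℤ.+ z))
∑-split zero n f = ∑-cong n (λ z → cong f (sym (ℤP.+-identityˡ z)))
∑-split (suc m) n f = begin
  f (+ 0) + ∑ (m + n) (λ z → f (+ 1 ℤ.+ z))
    ≡⟨ cong (_+_ (f (+ 0))) (∑-split m n _) ⟩
  f (+ 0) + (∑ m (λ z → f (+ 1 ℤ.+ z)) + ∑ n (λ z → f (+ 1 ℤ.+ (+ m ℤ.+ z))))
    ≡⟨ +-assoc (f (+ 0)) _ _ ⟨
  ∑ (suc m) f + ∑ n (λ z → f (+ 1 ℤ.+ (+ m ℤ.+ z)))
    ≡⟨ cong (_+_ (∑ (suc m) f)) (∑-cong n (λ z → cong f (sym (ℤP.+-assoc (+ 1) (+ m) z)))) ⟩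
  ∑ (suc m) f + ∑ n (λ z → f (+ suc m ℤ.+ z)) ∎

∑-periods : ∀ p q {f : ℤ → ℕ} → Periodic q f → ∑ (p * q) f ≡ p * ∑ q f
∑-periods zero q h = refl
∑-periods (suc p) q {f} h = begin
  ∑ (q + p * q) f                           ≡⟨ ∑-split q (p * q) f ⟩
  ∑ q f + ∑ (p * q) (λ z → f (+ q ℤ.+ z))   ≡⟨ cong (_+_ (∑ q f)) (∑-cong (p * q) h) ⟩
  ∑ q f + ∑ (p * q) f                       ≡⟨ cong (_+_ (∑ q f)) (∑-periods p q h) ⟩
  ∑ q f + p * ∑ q f                         ∎

∑-top : ∀ n (f : ℤ → ℕ) → ∑ n (λ z → f (+ 1 ℤ.+ z)) + f (+ 0) ≡ ∑ n f + f (+ n)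
∑-top zero f = refl
∑-top (suc n) f = begin
  f (+ 1) + ∑ n (λ z → f (+ 1 ℤ.+ (+ 1 ℤ.+ z))) + f (+ 0)
    ≡⟨ cong (_+ f (+ 0)) (+-comm (f (+ 1)) _) ⟩
  ∑ n (λ z → f (+ 1 ℤ.+ (+ 1 ℤ.+ z))) + f (+ 1) + f (+ 0)
    ≡⟨ cong (_+ f (+ 0)) (∑-top n (λ z → f (+ 1 ℤ.+ z))) ⟩
  ∑ n (λ z → f (+ 1 ℤ.+ z)) + f (+ suc n) + f (+ 0)
    ≡⟨ lem _ _ (f (+ 0)) ⟩
  f (+ 0) + ∑ n (λ z → f (+ 1 ℤ.+ z)) + f (+ suc n) ∎
  where
  lem : ∀ a b c → a + b + c ≡ c + a + b
  lem = ringℕ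

∑-shift₁ : ∀ n {f : ℤ → ℕ} → Periodic n f → ∑ n (λ z → f (+ 1 ℤ.+ z)) ≡ ∑ n f
∑-shift₁ n {f} h = +-cancelʳ-≡ (f (+ 0)) _ _ (begin
  ∑ n (λ z → f (+ 1 ℤ.+ z)) + f (+ 0)  ≡⟨ ∑-top n f ⟩
  ∑ n f + f (+ n)                      ≡⟨ cong (λ z → ∑ n f + f z) (sym (ℤP.+-identityʳ (+ n))) ⟩
  ∑ n f + f (+ n ℤ.+ + 0)              ≡⟨ cong (_+_ (∑ n f)) (h (+ 0)) ⟩
  ∑ n f + f (+ 0)                      ∎)

periodic-shift : ∀ n {f : ℤ → ℕ} k → Periodic n f → Periodic n (λ z → f (k ℤ.+ z))
periodic-shift n {f} k h z = trans (cong f (lem (+ n) k z)) (h (k ℤ.+ z))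
  where
  lem : ∀ n k z → k ℤ.+ (n ℤ.+ z) ≡ n ℤ.+ (k ℤ.+ z)
  lem = ringℤ

∑-shift : ∀ n {f : ℤ → ℕ} → Periodic n f → ∀ k → ∑ n (λ z → f (k ℤ.+ z)) ≡ ∑ n f
∑-shift n {f} h (+ zero) = ∑-cong n (λ z → cong f (ℤP.+-identityˡ z))
∑-shift n {f} h (+ suc k) = begin
  ∑ n (λ z → f (+ suc k ℤ.+ z))          ≡⟨ ∑-cong n (λ z → cong f (lem (+ k) z)) ⟩
  ∑ n (λ z → f (+ k ℤ.+ (+ 1 ℤ.+ z)))    ≡⟨ ∑-shift₁ n (periodic-shift n (+ k) h) ⟩
  ∑ n (λ z → f (+ k ℤ.+ z))              ≡⟨ ∑-shift n h (+ k) ⟩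
  ∑ n f                                  ∎
  where
  lem : ∀ k z → (+ 1 ℤ.+ k) ℤ.+ z ≡ k ℤ.+ (+ 1 ℤ.+ z)
  lem = ringℤ
∑-shift n {f} h -[1+ zero ] = begin
  ∑ n (λ z → f (- + 1 ℤ.+ z))              ≡⟨ ∑-shift₁ n (periodic-shift n (- + 1) h) ⟨
  ∑ n (λ z → f (- + 1 ℤ.+ (+ 1 ℤ.+ z)))    ≡⟨ ∑-cong n (λ z → cong f (lem z)) ⟩
  ∑ n f                                    ∎
  where
  lem : ∀ z → - + 1 ℤ.+ (+ 1 ℤ.+ z) ≡ z
  lem = ringℤ
∑-shift n {f} h -[1+ suc k ] = begin
  ∑ n (λ z → f (-[1+ suc k ] ℤ.+ z))
    ≡⟨ ∑-shift₁ n (periodic-shift n -[1+ suc k ] h) ⟨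
  ∑ n (λ z → f (-[1+ suc k ] ℤ.+ (+ 1 ℤ.+ z)))
    ≡⟨ ∑-cong n (λ z → cong f (lem (+ suc k) z)) ⟩
  ∑ n (λ z → f (-[1+ k ] ℤ.+ z))
    ≡⟨ ∑-shift n h -[1+ k ] ⟩
  ∑ n f ∎
  where
  lem : ∀ k z → - (+ 1 ℤ.+ k) ℤ.+ (+ 1 ℤ.+ z) ≡ - k ℤ.+ z
  lem = ringℤ

δ-periodic : ∀ n c t → Periodic n (λ z → δ n (z ℤ.* c ℤ.- t))
δ-periodic n c t z = δ-mod n _ _ (divides c (lem (+ n) z c t))
  where
  lem : ∀ n z c t → ((n ℤ.+ z) ℤ.* c ℤ.- t) ℤ.- (z ℤ.* c ℤ.- t) ≡ c ℤ.* n
  lem = ringℤ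

∑-zero : ∀ n {f : ℤ → ℕ} → (∀ i → i < n → f (+ i) ≡ 0) → ∑ n f ≡ 0
∑-zero zero h = refl
∑-zero (suc n) h = cong₂ _+_ (h 0 (s≤s z≤n)) (∑-zero n (λ i i<n → h (suc i) (s≤s i<n)))

∑-δ : ∀ n .{{_ : NonZero n}} k → ∑ n (λ z → δ n (k ℤ.+ z)) ≡ 1
∑-δ (suc n) k = trans (∑-shift (suc n) per k)
  (cong₂ _+_ (δ-true (suc n) (+ 0) (≡0⇒∣ refl)) (∑-zero n λ i i<n →
    δ-false (suc n) (+ suc i) (λ d → <-irrefl refl (<-≤-trans (s≤s i<n) (∣⇒≤ (∣⇒∣ᵤ d))))))
  where
  lem : ∀ n z → (n ℤ.+ z) ℤ.- z ≡ + 1 ℤ.* n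
  lem = ringℤ
  per : Periodic (suc n) (δ (suc n))
  per z = δ-mod (suc n) _ _ (divides (+ 1) (lem (+ suc n) z))

∑-δ-unit : ∀ n .{{_ : NonZero n}} x y h → + n ∣ℤ (h ℤ.* x ℤ.- + 1) →
           ∑ n (λ a → δ n (a ℤ.* x ℤ.- y)) ≡ 1
∑-δ-unit n x y h hx = trans
  (∑-cong n (λ a → δ-cong n n _ _
    (λ k → comb₂ h (- a) k hx (lem₁ a x y h))
    (λ k → comb₂ x y k hx (lem₂ a x y h))))
  (∑-δ n (- (h ℤ.* y)))
  where
  lem₁ : ∀ a x y h → - (h ℤ.* y) ℤ.+ a ≡ h ℤ.* (a ℤ.* x ℤ.- y) ℤ.+ (- a) ℤ.* (h ℤ.* x ℤ.- + 1)
  lem₁ = ringℤ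
  lem₂ : ∀ a x y h → a ℤ.* x ℤ.- y ≡ x ℤ.* (- (h ℤ.* y) ℤ.+ a) ℤ.+ y ℤ.* (h ℤ.* x ℤ.- + 1)
  lem₂ = ringℤ

-- Prime powers

inverse-mod-prime : ∀ {p} → Prime p → ∀ c → ¬ + p ∣ℤ c → ∃ λ h → + p ∣ℤ (h ℤ.* c ℤ.- + 1)
inverse-mod-prime {p} pr c ¬d = go (bez (coprime-Bézout cop))
  where
  cop : Coprime p ℤ.∣ c ∣
  cop {d} (d∣p , d∣c) with prime⇒irreducible pr d∣p
  ... | inj₁ d≡1 = d≡1
  ... | inj₂ refl = ⊥-elim (¬d (∣ᵤ⇒∣ d∣c))
  lem₁ : ∀ x y p c → (+ 1 ℤ.+ y ℤ.* c) ≡ x ℤ.* p → (- y) ℤ.* c ℤ.- + 1 ≡ (- x) ℤ.* p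
  lem₁ x y p c e = trans (l y c) (trans (cong -_ e) (ℤP.neg-distribˡ-* x p))
    where
    l : ∀ y c → (- y) ℤ.* c ℤ.- + 1 ≡ - (+ 1 ℤ.+ y ℤ.* c)
    l = ringℤ
  lem₂ : ∀ x y p c → (+ 1 ℤ.+ x ℤ.* p) ≡ y ℤ.* c → y ℤ.* c ℤ.- + 1 ≡ x ℤ.* p
  lem₂ x y p c e = trans (cong (ℤ._- + 1) (sym e)) (l x p)
    where
    l : ∀ x p → (+ 1 ℤ.+ x ℤ.* p) ℤ.- + 1 ≡ x ℤ.* p
    l = ringℤ
  cast : ∀ a b c d → 1 + a * b ≡ c * d → + 1 ℤ.+ + a ℤ.* + b ≡ + c ℤ.* + d
  cast a b c d e = trans (cong (ℤ._+_ (+ 1)) (sym (ℤP.pos-* a b))) (trans (cong +_ e) (ℤP.pos-* c d))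
  bez : Bézout.Identity 1 p ℤ.∣ c ∣ → ∃ λ h → + p ∣ℤ (h ℤ.* + ℤ.∣ c ∣ ℤ.- + 1)
  bez (Bézout.+- x y e) = - + y , divides (- + x) (lem₁ (+ x) (+ y) (+ p) _ (cast y _ x p e))
  bez (Bézout.-+ x y e) = + y , divides (+ x) (lem₂ (+ x) (+ y) (+ p) _ (cast x p y _ e))
  go : (∃ λ h → + p ∣ℤ (h ℤ.* + ℤ.∣ c ∣ ℤ.- + 1)) → ∃ λ h → + p ∣ℤ (h ℤ.* c ℤ.- + 1)
  go (h , d) with ℤP.+∣i∣≡i⊎+∣i∣≡-i c
  ... | inj₁ e = h , subst (λ z → + p ∣ℤ (h ℤ.* z ℤ.- + 1)) e d
  ... | inj₂ e = - h , subst (+ p ∣ℤ_) (trans (cong (λ z → h ℤ.* z ℤ.- + 1) e) (l h c)) d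
    where
    l : ∀ h c → h ℤ.* (- c) ℤ.- + 1 ≡ (- h) ℤ.* c ℤ.- + 1
    l = ringℤ

∣-*-cong : ∀ {i j x y} → i ∣ℤ x → j ∣ℤ y → i ℤ.* j ∣ℤ x ℤ.* y
∣-*-cong {i} {j} (divides q refl) (divides r refl) = divides (q ℤ.* r) (l q r i j)
  where
  l : ∀ q r i j → q ℤ.* i ℤ.* (r ℤ.* j) ≡ q ℤ.* r ℤ.* (i ℤ.* j)
  l = ringℤ

-- (h₁c − 1)(h₂c − 1) is 1 minus a multiple of c.
inverse-mod-* : ∀ p q c h₁ h₂ → + p ∣ℤ (h₁ ℤ.* c ℤ.- + 1) → + q ∣ℤ (h₂ ℤ.* c ℤ.- + 1) →
                ∃ λ h → + (p * q) ∣ℤ (h ℤ.* c ℤ.- + 1)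
inverse-mod-* p q c h₁ h₂ d₁ d₂ = h₁ ℤ.+ h₂ ℤ.- h₁ ℤ.* h₂ ℤ.* c ,
  comb₁ (- + 1) (subst (_∣ℤ _) (sym (ℤP.pos-* p q)) (∣-*-cong d₁ d₂)) (l h₁ h₂ c)
  where
  l : ∀ h₁ h₂ c → (h₁ ℤ.+ h₂ ℤ.- h₁ ℤ.* h₂ ℤ.* c) ℤ.* c ℤ.- + 1 ≡ (- + 1) ℤ.* ((h₁ ℤ.* c ℤ.- + 1) ℤ.* (h₂ ℤ.* c ℤ.- + 1))
  l = ringℤ

inverse-mod-^ : ∀ {p} → Prime p → ∀ c → ¬ + p ∣ℤ c → ∀ m → ∃ λ h → + (p ^ m) ∣ℤ (h ℤ.* c ℤ.- + 1)
inverse-mod-^ pr c ¬d zero = + 1 , divides (+ 1 ℤ.* c ℤ.- + 1) (sym (ℤP.*-identityʳ _))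
inverse-mod-^ {p} pr c ¬d (suc m) =
  let h₁ , d₁ = inverse-mod-prime pr c ¬d
      h₂ , d₂ = inverse-mod-^ pr c ¬d m
  in inverse-mod-* p (p ^ m) c h₁ h₂ d₁ d₂

top-multiple : ∀ {p} → Prime p → ∀ m c → ¬ + (p ^ suc m) ∣ℤ c →
               ∃ λ h → + (p ^ suc m) ∣ℤ (h ℤ.* c ℤ.- + (p ^ m))
top-multiple {p} pr m c ¬d with + p ∣ℤ? c
top-multiple {p} pr m c ¬d | no ¬p∣c =
  let h , d = inverse-mod-^ pr c ¬p∣c (suc m)
  in + (p ^ m) ℤ.* h , comb₁ (+ (p ^ m)) d (l (+ (p ^ m)) h c)
  where
  l : ∀ q h c → q ℤ.* h ℤ.* c ℤ.- q ≡ q ℤ.* (h ℤ.* c ℤ.- + 1)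
  l = ringℤ
top-multiple {p} pr zero c ¬d | yes p∣c =
  ⊥-elim (¬d (subst (λ z → + z ∣ℤ c) (sym (*-identityʳ p)) p∣c))
top-multiple {p} pr (suc m) c ¬d | yes (divides c′ refl) =
  let h , d = top-multiple pr m c′ (λ d → ¬d (subst (_∣ℤ c′ ℤ.* + p) (sym (ℤP.pos-* p (p ^ suc m)))
                (subst (+ p ℤ.* + (p ^ suc m) ∣ℤ_) (ℤP.*-comm (+ p) c′) (*-monoʳ-∣ (+ p) d))))
  in h , subst (_∣ℤ h ℤ.* (c′ ℤ.* + p) ℤ.- + (p ^ suc m)) (sym (ℤP.pos-* p (p ^ suc m)))
       (subst (+ p ℤ.* + (p ^ suc m) ∣ℤ_)
         (trans (l (+ p) h c′ (+ (p ^ m))) (cong (λ z → h ℤ.* (c′ ℤ.* + p) ℤ.- z) (sym (ℤP.pos-* p (p ^ m)))))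
         (*-monoʳ-∣ (+ p) d))
  where
  l : ∀ p h c q → p ℤ.* (h ℤ.* c ℤ.- q) ≡ h ℤ.* (c ℤ.* p) ℤ.- p ℤ.* q
  l = ringℤ

∣-*ˡ : ∀ p q → + q ∣ℤ + (p * q)
∣-*ˡ p q = divides (+ p) (ℤP.pos-* p q)

∑-δ-lifts : ∀ p q .{{_ : NonZero p}} .{{_ : NonZero q}} t →
            ∑ p (λ s → δ (p * q) (t ℤ.+ s ℤ.* + q)) ≡ δ q t
∑-δ-lifts p q t with + q ∣ℤ? t
... | yes (divides t′ refl) = begin
  ∑ p (λ s → δ (p * q) (t′ ℤ.* + q ℤ.+ s ℤ.* + q))
    ≡⟨ ∑-cong p (λ s → δ-cong (p * q) p _ _ (to s) (from s)) ⟩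
  ∑ p (λ s → δ p (t′ ℤ.+ s))
    ≡⟨ ∑-δ p t′ ⟩
  1
    ≡⟨ δ-true q (t′ ℤ.* + q) (divides t′ refl) ⟨
  δ q (t′ ℤ.* + q) ∎
  where
  l : ∀ q t s → q ℤ.* (t ℤ.+ s) ≡ t ℤ.* q ℤ.+ s ℤ.* q
  l = ringℤ
  e : + (p * q) ≡ + q ℤ.* + p
  e = trans (cong +_ (*-comm p q)) (ℤP.pos-* q p)
  to : ∀ s → + (p * q) ∣ℤ (t′ ℤ.* + q ℤ.+ s ℤ.* + q) → + p ∣ℤ (t′ ℤ.+ s)
  to s d rewrite e | sym (l (+ q) t′ s) = *-cancelˡ-∣ (+ q) d
  from : ∀ s → + p ∣ℤ (t′ ℤ.+ s) → + (p * q) ∣ℤ (t′ ℤ.* + q ℤ.+ s ℤ.* + q)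
  from s d rewrite e | sym (l (+ q) t′ s) = *-monoʳ-∣ (+ q) d
... | no ¬d = trans (∑-cong p (λ s → δ-false (p * q) (t ℤ.+ s ℤ.* + q) (λ d → ¬d
    (comb₂ (+ 1) (- s) (∣ℤ-trans (∣-*ˡ p q) d) ∣ℤ-refl (l t s (+ q))))))
  (trans (∑-const p 0) (trans (*-zeroʳ p) (sym (δ-false q t ¬d))))
  where
  l : ∀ t s q → t ≡ + 1 ℤ.* (t ℤ.+ s ℤ.* q) ℤ.+ (- s) ℤ.* q
  l = ringℤ

-- Some multiple hc is ≡ p^m mod p^(m+1); averaging over the shifts b ↦ b + sh, s < p,
-- turns solvability modulo p^(m+1) into solvability modulo p^m.
∑-δ-linear : ∀ {p} → Prime p → ∀ m c t → ¬ + (p ^ suc m) ∣ℤ c →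
  p * ∑ (p ^ suc m) (λ b → δ (p ^ suc m) (b ℤ.* c ℤ.- t)) ≡ ∑ (p ^ suc m) (λ b → δ (p ^ m) (b ℤ.* c ℤ.- t))
∑-δ-linear {p} pr m c t ¬d = begin
  p * ∑ Q f
    ≡⟨ ∑-const p (∑ Q f) ⟨
  ∑ p (λ _ → ∑ Q f)
    ≡⟨ ∑-cong p (λ s → ∑-shift Q (δ-periodic Q c t) (s ℤ.* h)) ⟨
  ∑ p (λ s → ∑ Q (λ b → f (s ℤ.* h ℤ.+ b)))
    ≡⟨ ∑-swap p Q _ ⟩
  ∑ Q (λ b → ∑ p (λ s → f (s ℤ.* h ℤ.+ b)))
    ≡⟨ ∑-cong Q (λ b → ∑-cong p (λ s → δ-mod Q _ _ (comb₁ s hc (l s h b c t (+ q))))) ⟩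
  ∑ Q (λ b → ∑ p (λ s → δ Q ((b ℤ.* c ℤ.- t) ℤ.+ s ℤ.* + q)))
    ≡⟨ ∑-cong Q (λ b → ∑-δ-lifts p q {{prime⇒nonZero pr}} {{m^n≢0 p m {{prime⇒nonZero pr}}}} (b ℤ.* c ℤ.- t)) ⟩
  ∑ Q (λ b → δ q (b ℤ.* c ℤ.- t)) ∎
  where
  Q q : ℕ
  Q = p ^ suc m
  q = p ^ m
  f : ℤ → ℕ
  f b = δ Q (b ℤ.* c ℤ.- t)
  h : ℤ
  h = proj₁ (top-multiple pr m c ¬d)
  hc : + Q ∣ℤ (h ℤ.* c ℤ.- + q)
  hc = proj₂ (top-multiple pr m c ¬d)
  l : ∀ s h b c t q → ((s ℤ.* h ℤ.+ b) ℤ.* c ℤ.- t) ℤ.- (b ℤ.* c ℤ.- t ℤ.+ s ℤ.* q) ≡ s ℤ.* (h ℤ.* c ℤ.- q)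
  l = ringℤ

∑-δ-step : ∀ {p} → Prime p → ∀ m c t → let q = p ^ m ; Q = p ^ suc m in
  p * ∑ Q (λ b → δ Q (b ℤ.* c ℤ.- t)) + Q * (δ Q c * δ q t)
    ≡ ∑ Q (λ b → δ q (b ℤ.* c ℤ.- t)) + p * Q * (δ Q c * δ Q t)
∑-δ-step {p} pr m c t with + (p ^ suc m) ∣ℤ? c
... | no ¬d rewrite δ-false (p ^ suc m) c ¬d | *-zeroʳ (p ^ suc m) | *-zeroʳ (p * p ^ suc m) = cong (_+ 0) (∑-δ-linear pr m c t ¬d)
... | yes d rewrite δ-true (p ^ suc m) c d = begin
  p * ∑ Q (λ b → δ Q (b ℤ.* c ℤ.- t)) + Q * (1 * δ q t)
    ≡⟨ cong (λ z → p * z + Q * (1 * δ q t)) (∑-δ∣ Q d) ⟩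
  p * (Q * δ Q t) + Q * (1 * δ q t)
    ≡⟨ lem p Q (δ Q t) (δ q t) ⟩
  Q * δ q t + p * Q * (1 * δ Q t)
    ≡⟨ cong (_+ p * Q * (1 * δ Q t)) (∑-δ∣ q (∣ℤ-trans (∣-*ˡ p q) d)) ⟨
  ∑ Q (λ b → δ q (b ℤ.* c ℤ.- t)) + p * Q * (1 * δ Q t) ∎
  where
  Q q : ℕ
  Q = p ^ suc m
  q = p ^ m
  lem : ∀ p Q a b → p * (Q * a) + Q * (1 * b) ≡ Q * b + p * Q * (1 * a)
  lem = ringℕ
  l₁ : ∀ b c t → t ≡ b ℤ.* c ℤ.+ (- + 1) ℤ.* (b ℤ.* c ℤ.- t)
  l₁ = ringℤ
  l₂ : ∀ b c t → b ℤ.* c ℤ.- t ≡ b ℤ.* c ℤ.+ (- + 1) ℤ.* t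
  l₂ = ringℤ
  ∑-δ∣ : ∀ n → + n ∣ℤ c → ∑ Q (λ b → δ n (b ℤ.* c ℤ.- t)) ≡ Q * δ n t
  ∑-δ∣ n d = trans (∑-cong Q (λ b → δ-cong n n _ _
      (λ k → comb₂ b (- + 1) d k (l₁ b c t))
      (λ k → comb₂ b (- + 1) d k (l₂ b c t))))
    (∑-const Q (δ n t))

-- Sums over words of residues acting on a state

T : (ℤ → X → X) → ℕ → ℕ → (X → ℕ) → X → ℕ
T act N zero f x = f x
T act N (suc k) f x = ∑ N (λ a → T act N k f (act a x))

step : (ℤ → X → X) → ℕ → (X → ℕ) → X → ℕ
step act N f x = ∑ N (λ a → f (act a x))

T-last : ∀ (act : ℤ → X → X) N k f x → T act N (suc k) f x ≡ T act N k (step act N f) x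
T-last act N zero f x = refl
T-last act N (suc k) f x = ∑-cong N (λ a → T-last act N k f (act a x))

T-cong : ∀ (act : ℤ → X → X) N (I : X → Set) → (∀ a x → I x → I (act a x)) →
         ∀ k {f g} → (∀ x → I x → f x ≡ g x) → ∀ x → I x → T act N k f x ≡ T act N k g x
T-cong act N I pres zero h x i = h x i
T-cong act N I pres (suc k) h x i = ∑-cong N (λ a → T-cong act N I pres k h (act a x) (pres a x i))

T-+ : ∀ (act : ℤ → X → X) N k f g x → T act N k (λ y → f y + g y) x ≡ T act N k f x + T act N k g x
T-+ act N zero f g x = refl
T-+ act N (suc k) f g x = trans (∑-cong N (λ a → T-+ act N k f g (act a x))) (∑-+ N _ _)

T-*ˡ : ∀ (act : ℤ → X → X) N k c f x → T act N k (λ y → c * f y) x ≡ c * T act N k f x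
T-*ˡ act N zero c f x = refl
T-*ˡ act N (suc k) c f x = trans (∑-cong N (λ a → T-*ˡ act N k c f (act a x))) (∑-*ˡ N c _)

T-one : ∀ (act : ℤ → X → X) N k x → T act N k (λ _ → 1) x ≡ N ^ k
T-one act N zero x = refl
T-one act N (suc k) x = trans (∑-cong N (λ a → T-one act N k (act a x))) (∑-const N (N ^ k))

T-map : ∀ (act : ℤ → X → X) (act′ : ℤ → Y → Y) N (φ : X → Y) → (∀ a x → φ (act a x) ≡ act′ a (φ x)) →
        ∀ k f x → T act N k (f ∘ φ) x ≡ T act′ N k f (φ x)
T-map act act′ N φ h zero f x = refl
T-map act act′ N φ h (suc k) f x = ∑-cong N (λ a →
  trans (T-map act act′ N φ h k f (act a x)) (cong (T act′ N k f) (h a x)))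

length-filter-map : ∀ {A B : Set} {R : B → Set} (R? : ∀ b → Dec (R b)) (g : A → B) xs →
                    length (filter R? (map g xs)) ≡ length (filter (R? ∘ g) xs)
length-filter-map R? g [] = refl
length-filter-map R? g (x ∷ xs) with R? (g x)
... | yes _ = cong suc (length-filter-map R? g xs)
... | no _ = length-filter-map R? g xs

length-filter-concatMap : ∀ {A B : Set} {R : B → Set} (R? : ∀ b → Dec (R b)) (F : A → List B)
  n (g : Fin n → A) (h : ℤ → ℕ) → (∀ i → length (filter R? (F (g i))) ≡ h (+ toℕ i)) →
  length (filter R? (concatMap F (tabulate g))) ≡ ∑ n h
length-filter-concatMap R? F zero g h e = refl
length-filter-concatMap R? F (suc n) g h e
  rewrite filter-++ R? (F (g fzero)) (concatMap F (tabulate (g ∘ fsuc)))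
  | length-++ (filter R? (F (g fzero))) {filter R? (concatMap F (tabulate (g ∘ fsuc)))} =
  cong₂ _+_ (e fzero) (length-filter-concatMap R? F n (g ∘ fsuc) (λ z → h (+ 1 ℤ.+ z)) (e ∘ fsuc))

mulA : ℤ → Mat → Mat
mulA a M = Aₘ a ⊗ M

count-words : ∀ {R : Mat → Set} (R? : ∀ M → Dec (R M)) N k M →
  length (filter (λ as → R? (M' M (toℤvec as))) (allVecs N k)) ≡ T mulA N k (ind ∘ R?) M
count-words R? N zero M with R? M
... | yes _ = refl
... | no _ = refl
count-words R? N (suc k) M =
  length-filter-concatMap (λ as → R? (M' M (toℤvec as))) (λ i → map (i ∷_) (allVecs N k)) N (λ i → i) _
    (λ i → trans (length-filter-map _ (i ∷_) (allVecs N k)) (count-words R? N k (Aₘ (+ toℕ i) ⊗ M)))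

-- Reduction to counting first columns

State : Set
State = ℤ × ℤ

next : ℤ → State → State
next a (x , y) = a ℤ.* x ℤ.- y , x

start : State
start = + 1 , + 0

col : Mat → State
col (x , _ , y , _) = x , y

F : ℕ → ℕ → ℤ → ℕ
F N k ε = T next N k (λ s → δ N (proj₁ s ℤ.+ ε)) start

%ℕ≡0⇒∣ : ∀ N .{{_ : NonZero N}} z → z %ℕ N ≡ 0 → + N ∣ℤ z
%ℕ≡0⇒∣ N z h = divides (z ℤ./ℕ N) (trans (a≡a%ℕn+[a/ℕn]*n z N)
  (trans (cong (λ r → + r ℤ.+ (z ℤ./ℕ N) ℤ.* + N) h) (ℤP.+-identityˡ _)))

∣⇒%ℕ≡0 : ∀ N .{{_ : NonZero N}} z → + N ∣ℤ z → z %ℕ N ≡ 0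
∣⇒%ℕ≡0 N (+ n) d = n∣m⇒m%n≡0 n N (∣⇒∣ᵤ d)
∣⇒%ℕ≡0 N@(suc _) -[1+ n ] d with suc n Data.Nat.% N | n∣m⇒m%n≡0 (suc n) N (∣⇒∣ᵤ d)
... | .0 | refl = refl

det : Mat → ℤ
det (x , z , y , t) = x ℤ.* t ℤ.- z ℤ.* y

mulA-≡ : ∀ a x z y t → mulA a (x , z , y , t) ≡ (a ℤ.* x ℤ.- y , a ℤ.* z ℤ.- t , x , z)
mulA-≡ a x z y t = cong₂ _,_ (l₁ a x y) (cong₂ _,_ (l₁ a z t) (cong₂ _,_ (l₂ x y) (l₂ z t)))
  where
  l₁ : ∀ a x y → a ℤ.* x ℤ.+ (- + 1) ℤ.* y ≡ a ℤ.* x ℤ.- y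
  l₁ = ringℤ
  l₂ : ∀ x y → + 1 ℤ.* x ℤ.+ + 0 ℤ.* y ≡ x
  l₂ = ringℤ

mulA₂-≡ : ∀ a b x z y t → mulA b (mulA a (x , z , y , t)) ≡
          (b ℤ.* (a ℤ.* x ℤ.- y) ℤ.- x , b ℤ.* (a ℤ.* z ℤ.- t) ℤ.- z , a ℤ.* x ℤ.- y , a ℤ.* z ℤ.- t)
mulA₂-≡ a b x z y t = trans (cong (mulA b) (mulA-≡ a x z y t)) (mulA-≡ b _ _ x z)

det-mulA : ∀ a M → det M ≡ + 1 → det (mulA a M) ≡ + 1
det-mulA a (x , z , y , t) h = trans (cong det (mulA-≡ a x z y t)) (trans (l a x z y t) h)
  where
  l : ∀ a x z y t → (a ℤ.* x ℤ.- y) ℤ.* z ℤ.- (a ℤ.* z ℤ.- t) ℤ.* x ≡ x ℤ.* t ℤ.- z ℤ.* y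
  l = ringℤ

module _ (N : ℕ) .{{_ : NonZero N}} (ε : ℤ) (ε² : ε ℤ.* ε ≡ + 1) where

  Diag? : ∀ M → Dec (IsDiagMod N ε ε M)
  Diag? = IsDiagMod? N ε ε

  ε²∣ : + N ∣ℤ (ε ℤ.* ε ℤ.- + 1)
  ε²∣ = ≡0⇒∣ (cong (ℤ._- + 1) ε²)

  Diag-to : ∀ a b x z y t → IsDiagMod N ε ε (mulA b (mulA a (x , z , y , t))) →
            + N ∣ℤ (x ℤ.+ ε) × + N ∣ℤ (ε ℤ.* y ℤ.+ a) × + N ∣ℤ (- (ε ℤ.* z) ℤ.+ b)
  Diag-to a b x z y t diag with h₁ , h₂ , h₃ , h₄ ← subst (IsDiagMod N ε ε) (mulA₂-≡ a b x z y t) diag =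
    e₀ ,
    subst (+ N ∣ℤ_) (l₅ a x y ε) (∣m∣n⇒∣m+n (comb₂ (- ε) (a ℤ.* ε) e₃ e₀ refl) (∣n⇒∣m*n (- a) ε²∣)) ,
    subst (+ N ∣ℤ_) (l₆ a b z t ε) (∣m∣n⇒∣m+n (comb₂ ε (- (ε ℤ.* b)) e₂ e₄ refl) (∣n⇒∣m*n (- b) ε²∣))
    where
    e₁ = %ℕ≡0⇒∣ N (b ℤ.* (a ℤ.* x ℤ.- y) ℤ.- x ℤ.- ε) h₁
    e₂ = %ℕ≡0⇒∣ N (b ℤ.* (a ℤ.* z ℤ.- t) ℤ.- z ℤ.- + 0) h₂
    e₃ = %ℕ≡0⇒∣ N (a ℤ.* x ℤ.- y ℤ.- + 0) h₃
    e₄ = %ℕ≡0⇒∣ N (a ℤ.* z ℤ.- t ℤ.- ε) h₄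
    l₀ : ∀ a b x y ε → x ℤ.+ ε ≡ b ℤ.* (a ℤ.* x ℤ.- y ℤ.- + 0) ℤ.+ (- + 1) ℤ.* (b ℤ.* (a ℤ.* x ℤ.- y) ℤ.- x ℤ.- ε)
    l₀ = ringℤ
    e₀ : + N ∣ℤ (x ℤ.+ ε)
    e₀ = comb₂ b (- + 1) e₃ e₁ (l₀ a b x y ε)
    l₅ : ∀ a x y ε → ((- ε) ℤ.* (a ℤ.* x ℤ.- y ℤ.- + 0) ℤ.+ (a ℤ.* ε) ℤ.* (x ℤ.+ ε)) ℤ.+ (- a) ℤ.* (ε ℤ.* ε ℤ.- + 1)
         ≡ ε ℤ.* y ℤ.+ a
    l₅ = ringℤ
    l₆ : ∀ a b z t ε →
         (ε ℤ.* (b ℤ.* (a ℤ.* z ℤ.- t) ℤ.- z ℤ.- + 0) ℤ.+ (- (ε ℤ.* b)) ℤ.* (a ℤ.* z ℤ.- t ℤ.- ε)) ℤ.+ (- b) ℤ.* (ε ℤ.* ε ℤ.- + 1)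
         ≡ - (ε ℤ.* z) ℤ.+ b
    l₆ = ringℤ

  Diag-from : ∀ a b x z y t → det (x , z , y , t) ≡ + 1 →
              + N ∣ℤ (x ℤ.+ ε) → + N ∣ℤ (ε ℤ.* y ℤ.+ a) → + N ∣ℤ (- (ε ℤ.* z) ℤ.+ b) →
              IsDiagMod N ε ε (mulA b (mulA a (x , z , y , t)))
  Diag-from a b x z y t det≡1 e₀ g h = subst (IsDiagMod N ε ε) (sym (mulA₂-≡ a b x z y t))
    ( ∣⇒%ℕ≡0 N _ (comb₂ b (- + 1) e₃ e₀ (l₁ a b x y ε))
    , ∣⇒%ℕ≡0 N _ (subst (+ N ∣ℤ_) (l₂ a b z t ε) (∣m∣n⇒∣m+n (comb₂ b ε e₄ h refl) (∣n⇒∣m*n z ε²∣)))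
    , ∣⇒%ℕ≡0 N _ e₃
    , ∣⇒%ℕ≡0 N _ e₄ )
    where
    d : + N ∣ℤ (x ℤ.* t ℤ.- z ℤ.* y ℤ.- + 1)
    d = ≡0⇒∣ (cong (ℤ._- + 1) det≡1)
    k₃ : ∀ a x y ε → (a ℤ.* (x ℤ.+ ε) ℤ.+ (- ε) ℤ.* (ε ℤ.* y ℤ.+ a)) ℤ.+ y ℤ.* (ε ℤ.* ε ℤ.- + 1) ≡ a ℤ.* x ℤ.- y ℤ.- + 0
    k₃ = ringℤ
    e₃ : + N ∣ℤ (a ℤ.* x ℤ.- y ℤ.- + 0)
    e₃ = subst (+ N ∣ℤ_) (k₃ a x y ε) (∣m∣n⇒∣m+n (comb₂ a (- ε) e₀ g refl) (∣n⇒∣m*n y ε²∣))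
    k₄ : ∀ a x z y t ε →
      (z ℤ.* (ε ℤ.* y ℤ.+ a) ℤ.+ (- (ε ℤ.* t)) ℤ.* (x ℤ.+ ε)) ℤ.+ (t ℤ.* (ε ℤ.* ε ℤ.- + 1) ℤ.+ ε ℤ.* (x ℤ.* t ℤ.- z ℤ.* y ℤ.- + 1))
      ≡ a ℤ.* z ℤ.- t ℤ.- ε
    k₄ = ringℤ
    e₄ : + N ∣ℤ (a ℤ.* z ℤ.- t ℤ.- ε)
    e₄ = subst (+ N ∣ℤ_) (k₄ a x z y t ε) (∣m∣n⇒∣m+n (comb₂ z (- (ε ℤ.* t)) g e₀ refl) (comb₂ t ε ε²∣ d refl))
    l₁ : ∀ a b x y ε → b ℤ.* (a ℤ.* x ℤ.- y) ℤ.- x ℤ.- ε ≡ b ℤ.* (a ℤ.* x ℤ.- y ℤ.- + 0) ℤ.+ (- + 1) ℤ.* (x ℤ.+ ε)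
    l₁ = ringℤ
    l₂ : ∀ a b z t ε →
         (b ℤ.* (a ℤ.* z ℤ.- t ℤ.- ε) ℤ.+ ε ℤ.* (- (ε ℤ.* z) ℤ.+ b)) ℤ.+ z ℤ.* (ε ℤ.* ε ℤ.- + 1)
         ≡ b ℤ.* (a ℤ.* z ℤ.- t) ℤ.- z ℤ.- + 0
    l₂ = ringℤ

  last-two : ∀ M → det M ≡ + 1 →
             step mulA N (step mulA N (ind ∘ Diag?)) M ≡ δ N (proj₁ (col M) ℤ.+ ε)
  last-two (x , z , y , t) det≡1 with + N ∣ℤ? (x ℤ.+ ε)
  ... | no ¬d = begin
    ∑ N (λ a → ∑ N (λ b → ind (Diag? (mulA b (mulA a (x , z , y , t))))))
      ≡⟨ ∑-cong N (λ a → ∑-cong N (λ b → ind-false (Diag? (mulA b (mulA a (x , z , y , t)))) (¬d ∘ proj₁ ∘ Diag-to a b x z y t))) ⟩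
    ∑ N (λ a → ∑ N (λ b → 0))
      ≡⟨ ∑-cong N (λ a → trans (∑-const N 0) (*-zeroʳ N)) ⟩
    ∑ N (λ a → 0)
      ≡⟨ trans (∑-const N 0) (*-zeroʳ N) ⟩
    0
      ≡⟨ δ-false N (x ℤ.+ ε) ¬d ⟨
    δ N (x ℤ.+ ε) ∎
  ... | yes d = begin
    ∑ N (λ a → ∑ N (λ b → ind (Diag? (mulA b (mulA a (x , z , y , t))))))
      ≡⟨ ∑-cong N (λ a → ∑-cong N (λ b → product a b)) ⟩
    ∑ N (λ a → ∑ N (λ b → δ N (ε ℤ.* y ℤ.+ a) * δ N (- (ε ℤ.* z) ℤ.+ b)))
      ≡⟨ ∑-cong N (λ a → trans (∑-*ˡ N (δ N (ε ℤ.* y ℤ.+ a)) _) (cong (_*_ (δ N (ε ℤ.* y ℤ.+ a))) (∑-δ N (- (ε ℤ.* z))))) ⟩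
    ∑ N (λ a → δ N (ε ℤ.* y ℤ.+ a) * 1)
      ≡⟨ ∑-cong N (λ a → *-identityʳ _) ⟩
    ∑ N (λ a → δ N (ε ℤ.* y ℤ.+ a))
      ≡⟨ ∑-δ N (ε ℤ.* y) ⟩
    1
      ≡⟨ δ-true N (x ℤ.+ ε) d ⟨
    δ N (x ℤ.+ ε) ∎
    where
    product : ∀ a b → ind (Diag? (mulA b (mulA a (x , z , y , t)))) ≡ δ N (ε ℤ.* y ℤ.+ a) * δ N (- (ε ℤ.* z) ℤ.+ b)
    product a b with + N ∣ℤ? (ε ℤ.* y ℤ.+ a) | + N ∣ℤ? (- (ε ℤ.* z) ℤ.+ b)
    ... | yes g | yes h = trans (ind-true (Diag? (mulA b (mulA a (x , z , y , t)))) (Diag-from a b x z y t det≡1 d g h))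
                            (sym (cong₂ _*_ (δ-true N _ g) (δ-true N _ h)))
    ... | no ¬g | _ = trans (ind-false (Diag? (mulA b (mulA a (x , z , y , t)))) (¬g ∘ proj₁ ∘ proj₂ ∘ Diag-to a b x z y t))
                        (sym (cong (_* δ N (- (ε ℤ.* z) ℤ.+ b)) (δ-false N _ ¬g)))
    ... | yes g | no ¬h = trans (ind-false (Diag? (mulA b (mulA a (x , z , y , t)))) (¬h ∘ proj₂ ∘ proj₂ ∘ Diag-to a b x z y t))
                        (sym (trans (cong (_*_ (δ N (ε ℤ.* y ℤ.+ a))) (δ-false N _ ¬h)) (*-zeroʳ (δ N (ε ℤ.* y ℤ.+ a)))))

  w≡F : ∀ k → w N (k + 2) ε ε ≡ F N k ε
  w≡F k rewrite +-comm k 2 = begin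
    w N (2 + k) ε ε
      ≡⟨ count-words Diag? N (2 + k) I₂ ⟩
    T mulA N (2 + k) (ind ∘ Diag?) I₂
      ≡⟨ T-last mulA N (suc k) _ I₂ ⟩
    T mulA N (suc k) (step mulA N (ind ∘ Diag?)) I₂
      ≡⟨ T-last mulA N k _ I₂ ⟩
    T mulA N k (step mulA N (step mulA N (ind ∘ Diag?))) I₂
      ≡⟨ T-cong mulA N (λ M → det M ≡ + 1) det-mulA k last-two I₂ refl ⟩
    T mulA N k ((λ s → δ N (proj₁ s ℤ.+ ε)) ∘ col) I₂
      ≡⟨ T-map mulA next N col col-mulA k _ I₂ ⟩
    F N k ε ∎
    where
    col-mulA : ∀ a M → col (mulA a M) ≡ next a (col M)
    col-mulA a (x , z , y , t) = cong col (mulA-≡ a x z y t)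

-- Changing the modulus

Invariant : ℕ → (State → ℕ) → Set
Invariant q f = ∀ x y x′ y′ → + q ∣ℤ (x ℤ.- x′) → + q ∣ℤ (y ℤ.- y′) → f (x , y) ≡ f (x′ , y′)

T-invariant : ∀ N q k {f} → Invariant q f → Invariant q (T next N k f)
T-invariant N q zero h = h
T-invariant N q (suc k) h x y x′ y′ dx dy = ∑-cong N (λ a → T-invariant N q k h _ _ _ _
  (comb₂ a (- + 1) dx dy (l a x y x′ y′)) dx)
  where
  l : ∀ a x y x′ y′ → (a ℤ.* x ℤ.- y) ℤ.- (a ℤ.* x′ ℤ.- y′) ≡ a ℤ.* (x ℤ.- x′) ℤ.+ (- + 1) ℤ.* (y ℤ.- y′)
  l = ringℤ

T-modulus : ∀ p q k {f} → Invariant q f → ∀ s → T next (p * q) k f s ≡ p ^ k * T next q k f s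
T-modulus p q zero h s = sym (+-identityʳ _)
T-modulus p q (suc k) {f} h s@(x , y) = begin
  ∑ (p * q) (λ a → T next (p * q) k f (next a s))
    ≡⟨ ∑-cong (p * q) (λ a → T-modulus p q k h (next a s)) ⟩
  ∑ (p * q) (λ a → p ^ k * T next q k f (next a s))
    ≡⟨ ∑-*ˡ (p * q) (p ^ k) _ ⟩
  p ^ k * ∑ (p * q) (λ a → T next q k f (next a s))
    ≡⟨ cong (_*_ (p ^ k)) (∑-periods p q per) ⟩
  p ^ k * (p * ∑ q (λ a → T next q k f (next a s)))
    ≡⟨ l (p ^ k) p _ ⟩
  p ^ suc k * T next q (suc k) f s ∎
  where
  l : ∀ a b c → a * (b * c) ≡ b * a * c
  l = ringℕ
  l′ : ∀ q a x y → ((q ℤ.+ a) ℤ.* x ℤ.- y) ℤ.- (a ℤ.* x ℤ.- y) ≡ x ℤ.* q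
  l′ = ringℤ
  per : Periodic q (λ a → T next q k f (next a s))
  per a = T-invariant q q k h _ _ _ _ (divides x (l′ (+ q) a x y)) (≡0⇒∣ (ℤP.+-inverseʳ x))

δ-invariant : ∀ q ε → Invariant q (λ s → δ q (proj₁ s ℤ.+ ε))
δ-invariant q ε x y x′ y′ dx dy = δ-mod q _ _ (subst (+ q ∣ℤ_) (l x x′ ε) dx)
  where
  l : ∀ x x′ ε → x ℤ.- x′ ≡ (x ℤ.+ ε) ℤ.- (x′ ℤ.+ ε)
  l = ringℤ

F-modulus : ∀ p q k ε → T next (p * q) k (λ s → δ q (proj₁ s ℤ.+ ε)) start ≡ p ^ k * F q k ε
F-modulus p q k ε = T-modulus p q k (δ-invariant q ε) start

T-ext : ∀ (act : ℤ → X → X) N k {f g : X → ℕ} → (∀ x → f x ≡ g x) → ∀ x → T act N k f x ≡ T act N k g x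
T-ext act N k h x = T-cong act N (λ _ → ⊤) (λ _ _ _ → tt) k (λ y _ → h y) x tt

-- The two-step recursion

module _ {p} (pr : Prime p) (m : ℕ) where

  private
    q Q : ℕ
    q = p ^ m
    Q = p ^ suc m

    instance
      Q≢0 : NonZero Q
      Q≢0 = m^n≢0 p (suc m) {{prime⇒nonZero pr}}

  last-zero : ℕ → ℤ → State → ℕ
  last-zero n ε s = δ Q (proj₁ s) * δ n (proj₂ s ℤ.- ε)

  F-last : ∀ k ε →
    p * F Q (2 + k) ε + Q * T next Q (suc k) (last-zero q ε) start
      ≡ T next Q (2 + k) (λ s → δ q (proj₁ s ℤ.+ ε)) start + p * Q * T next Q (suc k) (last-zero Q ε) start
  F-last k ε = begin
    p * F Q (2 + k) ε + Q * Tₖ (last-zero q ε)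
      ≡⟨ cong (λ z → p * z + Q * Tₖ (last-zero q ε)) (T-last next Q (suc k) _ start) ⟩
    p * Tₖ (step next Q (f Q)) + Q * Tₖ (last-zero q ε)
      ≡⟨ cong₂ _+_ (T-*ˡ next Q (suc k) p _ start) (T-*ˡ next Q (suc k) Q _ start) ⟨
    Tₖ (λ s → p * step next Q (f Q) s) + Tₖ (λ s → Q * last-zero q ε s)
      ≡⟨ T-+ next Q (suc k) _ _ start ⟨
    Tₖ (λ s → p * step next Q (f Q) s + Q * last-zero q ε s)
      ≡⟨ T-ext next Q (suc k) pointwise start ⟩
    Tₖ (λ s → step next Q (f q) s + p * Q * last-zero Q ε s)
      ≡⟨ T-+ next Q (suc k) _ _ start ⟩
    Tₖ (step next Q (f q)) + Tₖ (λ s → p * Q * last-zero Q ε s)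
      ≡⟨ cong₂ _+_ (sym (T-last next Q (suc k) (f q) start)) (T-*ˡ next Q (suc k) (p * Q) _ start) ⟩
    T next Q (2 + k) (f q) start + p * Q * Tₖ (last-zero Q ε) ∎
    where
    Tₖ : (State → ℕ) → ℕ
    Tₖ g = T next Q (suc k) g start
    f : ℕ → State → ℕ
    f n s = δ n (proj₁ s ℤ.+ ε)
    l : ∀ b c x ε → b ℤ.* c ℤ.- x ℤ.+ ε ≡ b ℤ.* c ℤ.- (x ℤ.- ε)
    l = ringℤ
    step-f : ∀ n c x → step next Q (f n) (c , x) ≡ ∑ Q (λ b → δ n (b ℤ.* c ℤ.- (x ℤ.- ε)))
    step-f n c x = ∑-cong Q (λ b → cong (δ n) (l b c x ε))
    pointwise : ∀ s → p * step next Q (f Q) s + Q * last-zero q ε s ≡ step next Q (f q) s + p * Q * last-zero Q ε s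
    pointwise (c , x) rewrite step-f Q c x | step-f q c x = ∑-δ-step pr m c (x ℤ.- ε)

  T-last-zero : ∀ n → + Q ∣ℤ + (n * n) → ∀ k ε → ε ℤ.* ε ≡ + 1 →
    T next Q (suc k) (last-zero n ε) start ≡ T next Q k (λ s → δ n (proj₁ s ℤ.- ε)) start
  T-last-zero n Q∣n² k ε ε² = trans (T-last next Q k _ start) (T-ext next Q k pointwise start)
    where
    l : ∀ x ε → ε ℤ.* x ℤ.- + 1 ≡ ε ℤ.* (x ℤ.- ε) ℤ.+ + 1 ℤ.* (ε ℤ.* ε ℤ.- + 1)
    l = ringℤ
    unit : ∀ x → + n ∣ℤ (x ℤ.- ε) → ∃ λ h → + Q ∣ℤ (h ℤ.* x ℤ.- + 1)
    unit x d = let i = comb₂ ε (+ 1) d (≡0⇒∣ (cong (ℤ._- + 1) ε²)) (l x ε)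
                   h , e = inverse-mod-* n n x ε ε i i
               in h , ∣ℤ-trans Q∣n² e
    pointwise : ∀ s → step next Q (last-zero n ε) s ≡ δ n (proj₁ s ℤ.- ε)
    pointwise (x , y) with + n ∣ℤ? (x ℤ.- ε)
    ... | no ¬d rewrite δ-false n (x ℤ.- ε) ¬d =
      trans (∑-cong Q (λ a → *-zeroʳ (δ Q (a ℤ.* x ℤ.- y)))) (trans (∑-const Q 0) (*-zeroʳ Q))
    ... | yes d rewrite δ-true n (x ℤ.- ε) d =
      trans (∑-cong Q (λ a → *-identityʳ (δ Q (a ℤ.* x ℤ.- y))))
        (∑-δ-unit Q x y (proj₁ (unit x d)) (proj₂ (unit x d)))

F-recursion : ∀ {p} → Prime p → ∀ m k ε → ε ℤ.* ε ≡ + 1 → let q = p ^ suc m ; Q = p ^ (2 + m) in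
  p * F Q (2 + k) ε + Q * (p ^ k * F q k (- ε)) ≡ p ^ (2 + k) * F q (2 + k) ε + p * Q * F Q k (- ε)
F-recursion {p} pr m k ε ε² = begin
  p * F Q (2 + k) ε + Q * (p ^ k * F q k (- ε))
    ≡⟨ cong (λ z → p * F Q (2 + k) ε + Q * z) (trans (T-last-zero pr (suc m) q Q∣q² k ε ε²) (F-modulus p q k (- ε))) ⟨
  p * F Q (2 + k) ε + Q * T next Q (suc k) (last-zero pr (suc m) q ε) start
    ≡⟨ F-last pr (suc m) k ε ⟩
  T next Q (2 + k) (λ s → δ q (proj₁ s ℤ.+ ε)) start + p * Q * T next Q (suc k) (last-zero pr (suc m) Q ε) start
    ≡⟨ cong₂ (λ y z → y + p * Q * z) (F-modulus p q (2 + k) ε) (T-last-zero pr (suc m) Q (∣-*ˡ Q Q) k ε ε²) ⟩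
  p ^ (2 + k) * F q (2 + k) ε + p * Q * F Q k (- ε) ∎
  where
  q Q : ℕ
  q = p ^ suc m
  Q = p ^ (2 + m)
  l : ∀ p r → r * (p * (p * r)) ≡ p * r * (p * r)
  l = ringℕ
  Q∣q² : + Q ∣ℤ + (q * q)
  Q∣q² = subst (λ z → + Q ∣ℤ + z) (l p (p ^ m)) (∣-*ˡ (p ^ m) Q)

-- Counting modulo p

Z : ℕ → ℕ → ℕ
Z p k = T next p k (λ s → δ p (proj₁ s)) start

Unimodular : State → Set
Unimodular (x , y) = ∃₂ λ α β → α ℤ.* x ℤ.+ β ℤ.* y ≡ + 1

next-unimodular : ∀ a s → Unimodular s → Unimodular (next a s)
next-unimodular a (x , y) (α , β , e) = - β , α ℤ.+ β ℤ.* a , trans (l a x y α β) e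
  where
  l : ∀ a x y α β → (- β) ℤ.* (a ℤ.* x ℤ.- y) ℤ.+ (α ℤ.+ β ℤ.* a) ℤ.* x ≡ α ℤ.* x ℤ.+ β ℤ.* y
  l = ringℤ

Z-recursion : ∀ {p} → Prime p → ∀ k → Z p (suc k) + Z p k ≡ p ^ k
Z-recursion {p} pr k = begin
  Z p (suc k) + Z p k
    ≡⟨ cong (_+ Z p k) (T-last next p k _ start) ⟩
  T next p k (step next p (λ s → δ p (proj₁ s))) start + Z p k
    ≡⟨ T-+ next p k _ _ start ⟨
  T next p k (λ s → step next p (λ s → δ p (proj₁ s)) s + δ p (proj₁ s)) start
    ≡⟨ T-cong next p Unimodular next-unimodular k pointwise start (+ 1 , + 0 , refl) ⟩
  T next p k (λ _ → 1) start
    ≡⟨ T-one next p k start ⟩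
  p ^ k ∎
  where
  instance
    p≢0 : NonZero p
    p≢0 = prime⇒nonZero pr
  l₁ : ∀ a x y → y ≡ a ℤ.* x ℤ.+ (- + 1) ℤ.* (a ℤ.* x ℤ.- y)
  l₁ = ringℤ
  p∤1 : ¬ + p ∣ℤ + 1
  p∤1 d = nonTrivial⇒≢1 {{prime⇒nonTrivial pr}} (∣1⇒≡1 (∣⇒∣ᵤ d))
  pointwise : ∀ s → Unimodular s → step next p (λ s → δ p (proj₁ s)) s + δ p (proj₁ s) ≡ 1
  pointwise (x , y) (α , β , e) with + p ∣ℤ? x
  ... | yes d rewrite δ-true p x d = cong (_+ 1) (trans
    (∑-cong p (λ a → δ-false p (a ℤ.* x ℤ.- y) (λ d′ → p∤1
      (comb₂ α β d (comb₂ a (- + 1) d d′ (l₁ a x y)) (sym e)))))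
    (trans (∑-const p 0) (*-zeroʳ p)))
  ... | no ¬d rewrite δ-false p x ¬d =
    let h , i = inverse-mod-prime pr x ¬d in trans (+-identityʳ _) (∑-δ-unit p x y h i)

F-recursion₁ : ∀ {p} → Prime p → ∀ k ε → ε ℤ.* ε ≡ + 1 →
  F p (2 + k) ε + Z p (suc k) ≡ p ^ suc k + p * F p k (- ε)
F-recursion₁ {p} pr k ε ε² = *-cancelˡ-≡ _ _ p {{prime⇒nonZero pr}} (begin
  p * (F p (2 + k) ε + Z p (suc k))
    ≡⟨ *-distribˡ-+ p (F p (2 + k) ε) _ ⟩
  p * F p (2 + k) ε + p * Z p (suc k)
    ≡⟨ subst (λ P → p * F P (2 + k) ε + P * Z P (suc k) ≡ P ^ (2 + k) + p * P * F P k (- ε)) (*-identityʳ p) F-last-1 ⟩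
  p ^ (2 + k) + p * p * F p k (- ε)
    ≡⟨ l p (p ^ suc k) _ ⟩
  p * (p ^ suc k + p * F p k (- ε)) ∎)
  where
  l : ∀ p a b → p * a + p * p * b ≡ p * (a + p * b)
  l = ringℕ
  Q : ℕ
  Q = p ^ 1
  δ-1 : ∀ z → δ 1 z ≡ 1
  δ-1 z = δ-true 1 z (divides z (sym (ℤP.*-identityʳ z)))
  F-last-1 : p * F Q (2 + k) ε + Q * Z Q (suc k) ≡ Q ^ (2 + k) + p * Q * F Q k (- ε)
  F-last-1 = begin
    p * F Q (2 + k) ε + Q * Z Q (suc k)
      ≡⟨ cong (λ z → p * F Q (2 + k) ε + Q * z) (T-ext next Q (suc k)
           (λ s → trans (cong (_*_ (δ Q (proj₁ s))) (δ-1 (proj₂ s ℤ.- ε))) (*-identityʳ (δ Q (proj₁ s)))) start) ⟨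
    p * F Q (2 + k) ε + Q * T next Q (suc k) (last-zero pr 0 1 ε) start
      ≡⟨ F-last pr 0 k ε ⟩
    T next Q (2 + k) (λ s → δ 1 (proj₁ s ℤ.+ ε)) start + p * Q * T next Q (suc k) (last-zero pr 0 Q ε) start
      ≡⟨ cong₂ (λ y z → y + p * Q * z)
           (trans (T-ext next Q (2 + k) (λ s → δ-1 (proj₁ s ℤ.+ ε)) start) (T-one next Q (2 + k) start))
           (T-last-zero pr 0 Q (∣-*ˡ Q Q) k ε ε²) ⟩
    Q ^ (2 + k) + p * Q * F Q k (- ε) ∎

-- Even length 2l, with the sign (−1)ˡ absorbed

sgn : ℕ → ℤ
sgn zero = + 1
sgn (suc l) = - sgn l

-- v = 1 is the case ε = (−1)ˡ, v = −1 the case ε = −(−1)ˡ in which a = 0 is a solution.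
S : ℕ → ℕ → ℤ → ℕ
S N l v = F N (2 * l) (sgn l ℤ.* v)

sgn² : ∀ l {v} → v ℤ.* v ≡ + 1 → (sgn l ℤ.* v) ℤ.* (sgn l ℤ.* v) ≡ + 1
sgn² zero {v} h = trans (l v) h
  where
  l : ∀ v → + 1 ℤ.* v ℤ.* (+ 1 ℤ.* v) ≡ v ℤ.* v
  l = ringℤ
sgn² (suc l) {v} h = trans (k (sgn l) v) (sgn² l h)
  where
  k : ∀ s v → (- s) ℤ.* v ℤ.* ((- s) ℤ.* v) ≡ s ℤ.* v ℤ.* (s ℤ.* v)
  k = ringℤ

-sgn-suc : ∀ l v → - (sgn (suc l) ℤ.* v) ≡ sgn l ℤ.* v
-sgn-suc l v = k (sgn l) v
  where
  k : ∀ s v → - ((- s) ℤ.* v) ≡ s ℤ.* v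
  k = ringℤ

S-recursion : ∀ {p} → Prime p → ∀ m l v → v ℤ.* v ≡ + 1 → let q = p ^ suc m ; Q = p ^ (2 + m) in
  p * S Q l v + Q ^ l * S q 0 v ≡ p ^ (2 * l) * S q l v + p * Q ^ l * S Q 0 v
S-recursion {p} pr m zero v v² = k p (S (p ^ (2 + m)) 0 v) (S (p ^ suc m) 0 v)
  where
  k : ∀ p a b → p * a + 1 * b ≡ 1 * b + p * 1 * a
  k = ringℕ
S-recursion {p} pr m (suc l) v v² = arith p (S Q (suc l) v) (S q (suc l) v) (S Q l v) (S q l v)
    (p ^ (2 * l)) (p ^ (2 * suc l)) Q (Q ^ l) (S q 0 v) (S Q 0 v) two-steps (S-recursion pr m l v v²)
  where
  q Q : ℕ
  q = p ^ suc m
  Q = p ^ (2 + m)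
  two-steps : p * S Q (suc l) v + Q * (p ^ (2 * l) * S q l v) ≡ p ^ (2 * suc l) * S q (suc l) v + p * Q * S Q l v
  two-steps = subst₂
    (λ n ε → p * F Q n (sgn (suc l) ℤ.* v) + Q * (p ^ (2 * l) * F q (2 * l) ε)
      ≡ p ^ n * F q n (sgn (suc l) ℤ.* v) + p * Q * F Q (2 * l) ε)
    (sym (*-suc 2 l)) (-sgn-suc l v) (F-recursion pr m (2 * l) (sgn (suc l) ℤ.* v) (sgn² (suc l) v²))
  arith : ∀ p S′ s′ S s P P′ Q Y e E → p * S′ + Q * (P * s) ≡ P′ * s′ + p * Q * S →
          p * S + Y * e ≡ P * s + p * Y * E → p * S′ + Q * Y * e ≡ P′ * s′ + p * (Q * Y) * E
  arith p S′ s′ S s P P′ Q Y e E h₁ h₂ = +-cancelʳ-≡ (Q * (P * s)) _ _ (begin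
    p * S′ + Q * Y * e + Q * (P * s)      ≡⟨ k₁ (p * S′) (Q * Y * e) (Q * (P * s)) ⟩
    p * S′ + Q * (P * s) + Q * Y * e      ≡⟨ cong (_+ Q * Y * e) h₁ ⟩
    P′ * s′ + p * Q * S + Q * Y * e       ≡⟨ k₂ (P′ * s′) p Q S Y e ⟩
    P′ * s′ + Q * (p * S + Y * e)         ≡⟨ cong (λ z → P′ * s′ + Q * z) h₂ ⟩
    P′ * s′ + Q * (P * s + p * Y * E)     ≡⟨ k₃ (P′ * s′) p Q P s Y E ⟩
    P′ * s′ + p * (Q * Y) * E + Q * (P * s) ∎)
    where
    k₁ : ∀ a b c → a + b + c ≡ a + c + b
    k₁ = ringℕ
    k₂ : ∀ a p Q S Y e → a + p * Q * S + Q * Y * e ≡ a + Q * (p * S + Y * e)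
    k₂ = ringℕ
    k₃ : ∀ a p Q P s Y E → a + Q * (P * s + p * Y * E) ≡ a + p * (Q * Y) * E + Q * (P * s)
    k₃ = ringℕ

Z-odd : ∀ {r} → Prime (suc r) → ∀ l → let p = suc r in Z p (suc (2 * l)) * (2 + r) ≡ p ^ suc (2 * l) + 1
Z-odd {r} pr zero = trans (cong (_* (2 + r)) Z₁) (k r)
  where
  k : ∀ r → 1 * (2 + r) ≡ suc r * 1 + 1
  k = ringℕ
  Z₀ : Z (suc r) 0 ≡ 0
  Z₀ = δ-false (suc r) (+ 1) (λ d → nonTrivial⇒≢1 {{prime⇒nonTrivial pr}} (∣1⇒≡1 (∣⇒∣ᵤ d)))
  Z₁ : Z (suc r) 1 ≡ 1
  Z₁ = trans (sym (+-identityʳ _)) (trans (cong (_+_ (Z (suc r) 1)) (sym Z₀)) (Z-recursion pr 0))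
Z-odd {r} pr (suc l) = subst (λ n → Z p (suc n) * (2 + r) ≡ p ^ suc n + 1) (sym (*-suc 2 l))
  (arith r (p ^ suc (2 * l)) (Z p (suc (2 * l))) (Z p (2 + 2 * l)) (Z p (3 + 2 * l))
    (Z-recursion pr (suc (2 * l))) (Z-recursion pr (2 + 2 * l)) (Z-odd pr l))
  where
  p : ℕ
  p = suc r
  arith : ∀ r P z₀ z₁ z₂ → z₁ + z₀ ≡ P → z₂ + z₁ ≡ suc r * P → z₀ * (2 + r) ≡ P + 1 →
          z₂ * (2 + r) ≡ suc r * (suc r * P) + 1
  arith r P z₀ z₁ z₂ h₁ h₂ h₃ = +-cancelʳ-≡ (z₁ * (2 + r) + (P + 1)) _ _ (begin
    z₂ * (2 + r) + (z₁ * (2 + r) + (P + 1))                  ≡⟨ k₁ z₂ z₁ r (P + 1) ⟩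
    (z₂ + z₁) * (2 + r) + (P + 1)                            ≡⟨ cong (λ z → z * (2 + r) + (P + 1)) h₂ ⟩
    suc r * P * (2 + r) + (P + 1)                            ≡⟨ k₂ r P ⟩
    suc r * (suc r * P) + 1 + P * (2 + r)                    ≡⟨ cong (λ z → suc r * (suc r * P) + 1 + z * (2 + r)) h₁ ⟨
    suc r * (suc r * P) + 1 + (z₁ + z₀) * (2 + r)            ≡⟨ cong (_+_ (suc r * (suc r * P) + 1)) (*-distribʳ-+ (2 + r) z₁ z₀) ⟩
    suc r * (suc r * P) + 1 + (z₁ * (2 + r) + z₀ * (2 + r))  ≡⟨ cong (λ z → suc r * (suc r * P) + 1 + (z₁ * (2 + r) + z)) h₃ ⟩
    suc r * (suc r * P) + 1 + (z₁ * (2 + r) + (P + 1))       ∎)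
    where
    k₁ : ∀ z₂ z₁ r c → z₂ * (2 + r) + (z₁ * (2 + r) + c) ≡ (z₂ + z₁) * (2 + r) + c
    k₁ = ringℕ
    k₂ : ∀ r P → suc r * P * (2 + r) + (P + 1) ≡ suc r * (suc r * P) + 1 + P * (2 + r)
    k₂ = ringℕ

^-double : ∀ p l → p ^ (2 * l) ≡ p ^ l * p ^ l
^-double p l = trans (cong (p ^_) (cong (_+_ l) (+-identityʳ l))) (^-distribˡ-+-* p l l)

S-prime : ∀ {r} → Prime (suc r) → ∀ l v → v ℤ.* v ≡ + 1 → let p = suc r ; P = p ^ l in
  S p l v * (r * (2 + r)) + (2 + r) * P ≡ p * P * P + 1 + S p 0 v * P * (r * (2 + r))
S-prime {r} pr zero v v² = k r (S (suc r) 0 v)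
  where
  k : ∀ r e → e * (r * (2 + r)) + (2 + r) * 1 ≡ suc r * 1 * 1 + 1 + e * 1 * (r * (2 + r))
  k = ringℕ
S-prime {r} pr (suc l) v v² = arith r (p ^ l) (p ^ suc (2 * l)) (S p l v) (S p (suc l) v) (Z p (suc (2 * l))) (S p 0 v)
    one-step (Z-odd pr l) (cong (_*_ p) (^-double p l)) (S-prime pr l v v²)
  where
  p : ℕ
  p = suc r
  one-step : S p (suc l) v + Z p (suc (2 * l)) ≡ p ^ suc (2 * l) + p * S p l v
  one-step = subst₂
    (λ n ε → F p n (sgn (suc l) ℤ.* v) + Z p (suc (2 * l)) ≡ p ^ suc (2 * l) + p * F p (2 * l) ε)
    (sym (*-suc 2 l)) (-sgn-suc l v) (F-recursion₁ pr (2 * l) (sgn (suc l) ℤ.* v) (sgn² (suc l) v²))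
  arith : ∀ r P X s s′ z e → s′ + z ≡ X + suc r * s → z * (2 + r) ≡ X + 1 → X ≡ suc r * (P * P) →
    s * (r * (2 + r)) + (2 + r) * P ≡ suc r * P * P + 1 + e * P * (r * (2 + r)) →
    s′ * (r * (2 + r)) + (2 + r) * (suc r * P)
      ≡ suc r * (suc r * P) * (suc r * P) + 1 + e * (suc r * P) * (r * (2 + r))
  arith r P _ s s′ z e h₁ h₂ refl h₃ = +-cancelʳ-≡ (r * (z * (2 + r))) _ _ (begin
    s′ * (r * (2 + r)) + (2 + r) * (suc r * P) + r * (z * (2 + r))
      ≡⟨ k₁ r s′ z P ⟩
    (s′ + z) * (r * (2 + r)) + (2 + r) * (suc r * P)
      ≡⟨ cong (λ y → y * (r * (2 + r)) + (2 + r) * (suc r * P)) h₁ ⟩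
    (suc r * (P * P) + suc r * s) * (r * (2 + r)) + (2 + r) * (suc r * P)
      ≡⟨ k₂ r P s ⟩
    suc r * (P * P) * (r * (2 + r)) + suc r * (s * (r * (2 + r)) + (2 + r) * P)
      ≡⟨ cong (λ y → suc r * (P * P) * (r * (2 + r)) + suc r * y) h₃ ⟩
    suc r * (P * P) * (r * (2 + r)) + suc r * (suc r * P * P + 1 + e * P * (r * (2 + r)))
      ≡⟨ k₃ r P e ⟩
    suc r * (suc r * P) * (suc r * P) + 1 + e * (suc r * P) * (r * (2 + r)) + r * (suc r * (P * P) + 1)
      ≡⟨ cong (λ y → suc r * (suc r * P) * (suc r * P) + 1 + e * (suc r * P) * (r * (2 + r)) + r * y) h₂ ⟨
    suc r * (suc r * P) * (suc r * P) + 1 + e * (suc r * P) * (r * (2 + r)) + r * (z * (2 + r)) ∎)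
    where
    k₁ : ∀ r s′ z P → s′ * (r * (2 + r)) + (2 + r) * (suc r * P) + r * (z * (2 + r))
       ≡ (s′ + z) * (r * (2 + r)) + (2 + r) * (suc r * P)
    k₁ = ringℕ
    k₂ : ∀ r P s → (suc r * (P * P) + suc r * s) * (r * (2 + r)) + (2 + r) * (suc r * P)
       ≡ suc r * (P * P) * (r * (2 + r)) + suc r * (s * (r * (2 + r)) + (2 + r) * P)
    k₂ = ringℕ
    k₃ : ∀ r P e → suc r * (P * P) * (r * (2 + r)) + suc r * (suc r * P * P + 1 + e * P * (r * (2 + r)))
       ≡ suc r * (suc r * P) * (suc r * P) + 1 + e * (suc r * P) * (r * (2 + r)) + r * (suc r * (P * P) + 1)
    k₃ = ringℕ

S₀-plus : ∀ N → ¬ N ∣ 2 → S N 0 (+ 1) ≡ 0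
S₀-plus N N∤2 = δ-false N (+ 2) (N∤2 ∘ ∣⇒∣ᵤ)

S₀-minus : ∀ N → S N 0 (- + 1) ≡ 1
S₀-minus N = δ-true N (+ 0) (≡0⇒∣ refl)

-- Prime powers: solving the recursion in the exponent

geometric : ∀ D K r (f G : ℕ → ℕ) → (∀ j → G (suc j) ≡ K * G j) →
  (∀ j → f (suc j) ≡ suc D * K * f j + r * G (suc j)) →
  ∀ j → f j * D + r * G j ≡ (suc D * K) ^ j * f 0 * D + r * suc D ^ j * G j
geometric D K r f G hG hf zero = k (f 0) D r (G 0)
  where
  k : ∀ f D r G → f * D + r * G ≡ 1 * f * D + r * 1 * G
  k = ringℕ
geometric D K r f G hG hf (suc j) rewrite hf j | hG j = begin
  (suc D * K * f j + r * (K * G j)) * D + r * (K * G j)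
    ≡⟨ k₁ D K r (f j) (G j) ⟩
  suc D * K * (f j * D + r * G j)
    ≡⟨ cong (_*_ (suc D * K)) (geometric D K r f G hG hf j) ⟩
  suc D * K * ((suc D * K) ^ j * f 0 * D + r * suc D ^ j * G j)
    ≡⟨ k₂ (suc D) K ((suc D * K) ^ j) (f 0) D r (suc D ^ j) (G j) ⟩
  (suc D * K) ^ suc j * f 0 * D + r * suc D ^ suc j * (K * G j) ∎
  where
  k₁ : ∀ D K r f G → (suc D * K * f + r * (K * G)) * D + r * (K * G) ≡ suc D * K * (f * D + r * G)
  k₁ = ringℕ
  k₂ : ∀ s K a f D r b G → s * K * (a * f * D + r * b * G) ≡ s * K * a * f * D + r * (s * b) * (K * G)
  k₂ = ringℕ

geometric₀ : ∀ c (f : ℕ → ℕ) → (∀ j → f (suc j) ≡ c * f j) → ∀ j → f j ≡ c ^ j * f 0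
geometric₀ c f h zero = sym (+-identityʳ (f 0))
geometric₀ c f h (suc j) = trans (h j) (trans (cong (_*_ c) (geometric₀ c f h j)) (sym (*-assoc c (c ^ j) (f 0))))

^-suc-pred : ∀ p .{{_ : NonZero p}} n → p ^ n ≡ suc (p ^ n ∸ 1)
^-suc-pred p n = sym (suc-pred (p ^ n) {{m^n≢0 p n}})

module _ {r} (pr : Prime (suc r)) (l′ : ℕ) where

  private
    p l c : ℕ
    p = suc r
    l = suc l′
    c = 2 * l ∸ 1

  S-plus-step : ∀ m → ¬ p ^ suc m ∣ 2 → S (p ^ (2 + m)) l (+ 1) ≡ p ^ c * S (p ^ suc m) l (+ 1)
  S-plus-step m q∤2 = *-cancelˡ-≡ _ _ p (begin
    p * S Q l (+ 1)                           ≡⟨ +-identityʳ _ ⟨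
    p * S Q l (+ 1) + 0                       ≡⟨ cong (_+_ (p * S Q l (+ 1))) (*-zeroʳ (Q ^ l)) ⟨
    p * S Q l (+ 1) + Q ^ l * 0               ≡⟨ cong (λ z → p * S Q l (+ 1) + Q ^ l * z) (S₀-plus q q∤2) ⟨
    p * S Q l (+ 1) + Q ^ l * S q 0 (+ 1)     ≡⟨ S-recursion pr m l (+ 1) refl ⟩
    p * p ^ c * S q l (+ 1) + p * Q ^ l * S Q 0 (+ 1)
      ≡⟨ cong (λ z → p * p ^ c * S q l (+ 1) + p * Q ^ l * z) (S₀-plus Q (q∤2 ∘ ∣-trans (divides p refl))) ⟩
    p * p ^ c * S q l (+ 1) + p * Q ^ l * 0   ≡⟨ k p (p ^ c) (S q l (+ 1)) (Q ^ l) ⟩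
    p * (p ^ c * S q l (+ 1))                 ∎)
    where
    q Q : ℕ
    q = p ^ suc m
    Q = p ^ (2 + m)
    k : ∀ p c s Y → p * c * s + p * Y * 0 ≡ p * (c * s)
    k = ringℕ

  S-minus-step : ∀ m → S (p ^ (2 + m)) l (- + 1) ≡ p ^ c * S (p ^ suc m) l (- + 1) + r * p ^ ((2 + m) * l ∸ 1)
  S-minus-step m = *-cancelˡ-≡ _ _ p (+-cancelʳ-≡ (Q ^ l * 1) _ _ (begin
    p * S Q l (- + 1) + Q ^ l * 1               ≡⟨ cong (λ z → p * S Q l (- + 1) + Q ^ l * z) (S₀-minus q) ⟨
    p * S Q l (- + 1) + Q ^ l * S q 0 (- + 1)   ≡⟨ S-recursion pr m l (- + 1) refl ⟩
    p * p ^ c * S q l (- + 1) + p * Q ^ l * S Q 0 (- + 1)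
      ≡⟨ cong (λ z → p * p ^ c * S q l (- + 1) + p * Q ^ l * z) (S₀-minus Q) ⟩
    p * p ^ c * S q l (- + 1) + p * Q ^ l * 1
      ≡⟨ cong (λ z → p * p ^ c * S q l (- + 1) + p * z * 1) Q^l ⟩
    p * p ^ c * S q l (- + 1) + p * (p * g) * 1
      ≡⟨ k r (p ^ c) (S q l (- + 1)) g ⟩
    p * (p ^ c * S q l (- + 1) + r * g) + p * g * 1
      ≡⟨ cong (λ z → p * (p ^ c * S q l (- + 1) + r * g) + z * 1) Q^l ⟨
    p * (p ^ c * S q l (- + 1) + r * g) + Q ^ l * 1 ∎))
    where
    q Q g : ℕ
    q = p ^ suc m
    Q = p ^ (2 + m)
    g = p ^ ((2 + m) * l ∸ 1)
    Q^l : Q ^ l ≡ p * g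
    Q^l = ^-*-assoc p (2 + m) l
    k : ∀ r c s g → suc r * c * s + suc r * (suc r * g) * 1 ≡ suc r * (c * s + r * g) + suc r * g * 1
    k = ringℕ

  private
    D : ℕ
    D = p ^ (c ∸ l) ∸ 1

  c∸l : c ∸ l ≡ l′
  c∸l = trans (cong (_∸ l) (trans (cong (λ z → l′ + suc z) (+-identityʳ l′)) (+-comm l′ l))) (m+n∸m≡n l l′)

  c-split : p ^ c ≡ suc D * p ^ l
  c-split = begin
    p ^ c                   ≡⟨ cong (λ z → p ^ (l′ + suc z)) (+-identityʳ l′) ⟩
    p ^ (l′ + l)            ≡⟨ ^-distribˡ-+-* p l′ l ⟩
    p ^ l′ * p ^ l          ≡⟨ cong (λ z → p ^ z * p ^ l) c∸l ⟨
    p ^ (c ∸ l) * p ^ l     ≡⟨ cong (_* p ^ l) (^-suc-pred p (c ∸ l)) ⟩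
    suc D * p ^ l           ∎

  ^-* : ∀ a j → (p ^ a) ^ j ≡ p ^ (j * a)
  ^-* a j = trans (^-*-assoc p a j) (cong (p ^_) (*-comm a j))

  S-plus-closed : ∀ i → ¬ p ^ suc i ∣ 2 → ∀ j →
    S (p ^ (suc i + j)) l (+ 1) ≡ p ^ (j * c) * S (p ^ suc i) l (+ 1)
  S-plus-closed i h j = begin
    f j                             ≡⟨ geometric₀ (p ^ c) f (λ j → trans (cong (λ z → S (p ^ suc z) l (+ 1)) (+-suc i j))
                                         (S-plus-step (i + j) (h ∘ ∣-trans (i≤ j)))) j ⟩
    (p ^ c) ^ j * f 0               ≡⟨ cong₂ _*_ (^-* c j) (cong (λ z → S (p ^ suc z) l (+ 1)) (+-identityʳ i)) ⟩
    p ^ (j * c) * S (p ^ suc i) l (+ 1) ∎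
    where
    f : ℕ → ℕ
    f j = S (p ^ (suc i + j)) l (+ 1)
    i≤ : ∀ j → p ^ suc i ∣ p ^ suc (i + j)
    i≤ j = divides (p ^ j) (trans (^-distribˡ-+-* p (suc i) j) (*-comm (p ^ suc i) (p ^ j)))

  S-minus-closed : ∀ i j →
    S (p ^ (suc i + j)) l (- + 1) * D
      ≡ p ^ (j * c) * S (p ^ suc i) l (- + 1) * D + (p ^ (j * (c ∸ l)) ∸ 1) * (p ^ ((suc i + j) * l ∸ 1) * r)
  S-minus-closed i j = +-cancelʳ-≡ (r * G j) _ _ (begin
    f j * D + r * G j
      ≡⟨ geometric D (p ^ l) r f G G-step f-step j ⟩
    (suc D * p ^ l) ^ j * f 0 * D + r * suc D ^ j * G j
      ≡⟨ cong₂ (λ y z → y * f 0 * D + r * z * G j)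
           (trans (cong (_^ j) (sym c-split)) (^-* c j))
           (trans (cong (_^ j) (sym (^-suc-pred p (c ∸ l)))) (trans (^-* (c ∸ l) j) (^-suc-pred p (j * (c ∸ l))))) ⟩
    p ^ (j * c) * f 0 * D + r * suc b * G j
      ≡⟨ k (p ^ (j * c) * f 0 * D) r b (G j) ⟩
    p ^ (j * c) * f 0 * D + b * (G j * r) + r * G j
      ≡⟨ cong (λ z → p ^ (j * c) * S (p ^ suc z) l (- + 1) * D + b * (G j * r) + r * G j) (+-identityʳ i) ⟩
    p ^ (j * c) * S (p ^ suc i) l (- + 1) * D + b * (G j * r) + r * G j ∎)
    where
    f G : ℕ → ℕ
    f j = S (p ^ (suc i + j)) l (- + 1)
    G j = p ^ ((suc i + j) * l ∸ 1)
    b : ℕ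
    b = p ^ (j * (c ∸ l)) ∸ 1
    k : ∀ a r b G → a + r * suc b * G ≡ a + b * (G * r) + r * G
    k = ringℕ
    k′ : ∀ l a → l + (suc l + a) ≡ suc l + (l + a)
    k′ = ringℕ
    G-step : ∀ j → G (suc j) ≡ p ^ l * G j
    G-step j = begin
      p ^ ((suc i + suc j) * l ∸ 1)     ≡⟨ cong (λ z → p ^ (suc z * l ∸ 1)) (+-suc i j) ⟩
      p ^ (l′ + (l + (i + j) * l))      ≡⟨ cong (p ^_) (k′ l′ ((i + j) * l)) ⟩
      p ^ (l + (l′ + (i + j) * l))      ≡⟨ ^-distribˡ-+-* p l (l′ + (i + j) * l) ⟩
      p ^ l * G j                       ∎
    f-step : ∀ j → f (suc j) ≡ suc D * p ^ l * f j + r * G (suc j)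
    f-step j = subst₂ (λ m x → S (p ^ suc m) l (- + 1) ≡ x * f j + r * p ^ (suc m * l ∸ 1))
      (sym (+-suc i j)) c-split (S-minus-step (i + j))

  A : ℕ
  A = (p ^ (l + 1) ∸ 1) * (p ^ l ∸ 1)

  p²∸1 : p ^ 2 ∸ 1 ≡ r * (2 + r)
  p²∸1 = k r
    where
    k : ∀ r → r * 1 + r * suc (r * 1) ≡ r * (2 + r)
    k = ringℕ

  A-expand : A + (2 + r) * p ^ l ≡ p * p ^ l * p ^ l + 1
  A-expand = begin
    (p ^ (l + 1) ∸ 1) * β + (2 + r) * p ^ l           ≡⟨ cong (λ z → (p ^ z ∸ 1) * β + (2 + r) * p ^ l) (+-comm l 1) ⟩
    (p * p ^ l ∸ 1) * β + (2 + r) * p ^ l             ≡⟨ cong (λ z → (p * z ∸ 1) * β + (2 + r) * z) (^-suc-pred p l) ⟩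
    (β + r * suc β) * β + (2 + r) * suc β             ≡⟨ k r β ⟩
    p * suc β * suc β + 1                             ≡⟨ cong (λ z → p * z * z + 1) (^-suc-pred p l) ⟨
    p * p ^ l * p ^ l + 1                             ∎
    where
    β : ℕ
    β = p ^ l ∸ 1
    k : ∀ r β → (β + r * suc β) * β + (2 + r) * suc β ≡ suc r * suc β * suc β + 1
    k = ringℕ

  S-prime-closed : ∀ v → v ℤ.* v ≡ + 1 →
    S (p ^ 1) l v * (p ^ 2 ∸ 1) ≡ A + S p 0 v * p ^ l * (p ^ 2 ∸ 1)
  S-prime-closed v v² = subst₂ (λ q x → S q l v * x ≡ A + S p 0 v * p ^ l * x) (sym (*-identityʳ p)) (sym p²∸1) (+-cancelʳ-≡ ((2 + r) * p ^ l) _ _ (begin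
    S p l v * (r * (2 + r)) + (2 + r) * p ^ l                ≡⟨ S-prime pr l v v² ⟩
    p * p ^ l * p ^ l + 1 + e                                ≡⟨ cong (_+ e) A-expand ⟨
    A + (2 + r) * p ^ l + e                                  ≡⟨ k A ((2 + r) * p ^ l) e ⟩
    A + e + (2 + r) * p ^ l                                  ∎))
    where
    e : ℕ
    e = S p 0 v * p ^ l * (r * (2 + r))
    k : ∀ a b c → a + b + c ≡ a + c + b
    k = ringℕ

  S-plus-odd : ¬ 2 ∣ p → ∀ j → S (p ^ (1 + j)) l (+ 1) * (p ^ 2 ∸ 1) ≡ p ^ (j * c) * A
  S-plus-odd 2∤p j = begin
    S (p ^ (1 + j)) l (+ 1) * (p ^ 2 ∸ 1)
      ≡⟨ cong (_* (p ^ 2 ∸ 1)) (S-plus-closed 0 (p∤2 ∘ subst (_∣ 2) (*-identityʳ p)) j) ⟩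
    p ^ (j * c) * S (p ^ 1) l (+ 1) * (p ^ 2 ∸ 1)
      ≡⟨ *-assoc (p ^ (j * c)) _ _ ⟩
    p ^ (j * c) * (S (p ^ 1) l (+ 1) * (p ^ 2 ∸ 1))
      ≡⟨ cong (_*_ (p ^ (j * c))) (S-prime-closed (+ 1) refl) ⟩
    p ^ (j * c) * (A + S p 0 (+ 1) * p ^ l * (p ^ 2 ∸ 1))
      ≡⟨ cong (λ z → p ^ (j * c) * (A + z * p ^ l * (p ^ 2 ∸ 1))) (S₀-plus p p∤2) ⟩
    p ^ (j * c) * (A + 0)
      ≡⟨ cong (_*_ (p ^ (j * c))) (+-identityʳ A) ⟩
    p ^ (j * c) * A ∎
    where
    p∤2 : ¬ p ∣ 2
    p∤2 d = 2∤p (subst (2 ∣_) (≤-antisym (nonTrivial⇒n>1 p {{prime⇒nonTrivial pr}}) (∣⇒≤ d)) ∣-refl)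

  S-minus-all : ∀ j → S (p ^ (1 + j)) l (- + 1) * ((p ^ 2 ∸ 1) * D)
    ≡ p ^ (j * c) * (A + p ^ l * (p ^ 2 ∸ 1)) * D
      + (p ^ (j * (c ∸ l)) ∸ 1) * (p ^ ((1 + j) * l ∸ 1) * r) * (p ^ 2 ∸ 1)
  S-minus-all j = begin
    s * (w₀ * D)                            ≡⟨ k₁ s w₀ D ⟩
    s * D * w₀                              ≡⟨ cong (_* w₀) (S-minus-closed 0 j) ⟩
    (E * s₁ * D + B) * w₀                   ≡⟨ k₂ E s₁ D B w₀ ⟩
    E * (s₁ * w₀) * D + B * w₀              ≡⟨ cong (λ z → E * z * D + B * w₀) (S-prime-closed (- + 1) refl) ⟩
    E * (A + S p 0 (- + 1) * p ^ l * w₀) * D + B * w₀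
      ≡⟨ cong (λ z → E * (A + z * w₀) * D + B * w₀) (trans (cong (_* p ^ l) (S₀-minus p)) (*-identityˡ (p ^ l))) ⟩
    E * (A + p ^ l * w₀) * D + B * w₀       ∎
    where
    s s₁ w₀ E B : ℕ
    s = S (p ^ (1 + j)) l (- + 1)
    s₁ = S (p ^ 1) l (- + 1)
    w₀ = p ^ 2 ∸ 1
    E = p ^ (j * c)
    B = (p ^ (j * (c ∸ l)) ∸ 1) * (p ^ ((1 + j) * l ∸ 1) * r)
    k₁ : ∀ s w D → s * (w * D) ≡ s * D * w
    k₁ = ringℕ
    k₂ : ∀ E s D B w → (E * s * D + B) * w ≡ E * (s * w) * D + B * w
    k₂ = ringℕ

-- Powers of 2

S-2 : ∀ l v → v ℤ.* v ≡ + 1 → S 2 0 v ≡ 1 → S 2 l v * 3 ≡ 2 * 2 ^ (2 * l) + 1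
S-2 l v v² e = +-cancelʳ-≡ (3 * 2 ^ l) _ _ (begin
  S 2 l v * 3 + 3 * P                 ≡⟨ S-prime prime[2] l v v² ⟩
  2 * P * P + 1 + S 2 0 v * P * 3     ≡⟨ cong (λ z → 2 * P * P + 1 + z * P * 3) e ⟩
  2 * P * P + 1 + 1 * P * 3           ≡⟨ k P ⟩
  2 * (P * P) + 1 + 3 * P             ≡⟨ cong (λ z → 2 * z + 1 + 3 * P) (^-double 2 l) ⟨
  2 * 2 ^ (2 * l) + 1 + 3 * P         ∎)
  where
  P : ℕ
  P = 2 ^ l
  k : ∀ P → 2 * P * P + 1 + 1 * P * 3 ≡ 2 * (P * P) + 1 + 3 * P
  k = ringℕ

S-4 : ∀ l v → v ℤ.* v ≡ + 1 → S 2 0 v ≡ 1 → let W = 2 ^ (2 * l) in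
      S 4 l v * 3 + W ≡ W * W + 3 * W * S 4 0 v
S-4 l v v² e = *-cancelˡ-≡ _ _ 2 (+-cancelʳ-≡ W _ _ (begin
  2 * (S 4 l v * 3 + W) + W           ≡⟨ k₁ (S 4 l v) W ⟩
  3 * (2 * S 4 l v + W * 1)           ≡⟨ cong (λ z → 3 * (2 * S 4 l v + W * z)) e ⟨
  3 * (2 * S 4 l v + W * S 2 0 v)     ≡⟨ cong (λ z → 3 * (2 * S 4 l v + z * S 2 0 v)) 4^l ⟨
  3 * (2 * S 4 l v + 4 ^ l * S 2 0 v) ≡⟨ cong (_*_ 3) (S-recursion prime[2] 0 l v v²) ⟩
  3 * (W * S 2 l v + 2 * 4 ^ l * S 4 0 v) ≡⟨ cong (λ z → 3 * (W * S 2 l v + 2 * z * S 4 0 v)) 4^l ⟩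
  3 * (W * S 2 l v + 2 * W * S 4 0 v) ≡⟨ k₂ W (S 2 l v) (S 4 0 v) ⟩
  W * (S 2 l v * 3) + 6 * W * S 4 0 v ≡⟨ cong (λ z → W * z + 6 * W * S 4 0 v) (S-2 l v v² e) ⟩
  W * (2 * W + 1) + 6 * W * S 4 0 v   ≡⟨ k₃ W (S 4 0 v) ⟩
  2 * (W * W + 3 * W * S 4 0 v) + W   ∎))
  where
  W : ℕ
  W = 2 ^ (2 * l)
  4^l : 4 ^ l ≡ W
  4^l = ^-*-assoc 2 2 l
  k₁ : ∀ s W → 2 * (s * 3 + W) + W ≡ 3 * (2 * s + W * 1)
  k₁ = ringℕ
  k₂ : ∀ W s e → 3 * (W * s + 2 * W * e) ≡ W * (s * 3) + 6 * W * e
  k₂ = ringℕ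
  k₃ : ∀ W e → W * (2 * W + 1) + 6 * W * e ≡ 2 * (W * W + 3 * W * e) + W
  k₃ = ringℕ

4^≡ : ∀ n → 4 ^ n ≡ 2 ^ n * 2 ^ n
4^≡ n = trans (^-*-assoc 2 2 n) (^-double 2 n)

2^2∤2 : ¬ 2 ^ 2 ∣ 2
2^2∤2 d with ∣⇒≤ d
... | s≤s (s≤s ())

S-plus-2 : ∀ l′ j → let l = suc l′ ; n = 2 * l in
  S (2 ^ (2 + j)) l (+ 1) * 3 ≡ 2 ^ (j * (n ∸ 1)) * (4 ^ n ∸ 2 ^ n)
S-plus-2 l′ j = begin
  S (2 ^ (2 + j)) l (+ 1) * 3  ≡⟨ cong (_* 3) (S-plus-closed prime[2] l′ 1 2^2∤2 j) ⟩
  E * S 4 l (+ 1) * 3          ≡⟨ *-assoc E (S 4 l (+ 1)) 3 ⟩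
  E * (S 4 l (+ 1) * 3)        ≡⟨ cong (_*_ E) (m+n∸n≡m (S 4 l (+ 1) * 3) W) ⟨
  E * (S 4 l (+ 1) * 3 + W ∸ W) ≡⟨ cong (λ z → E * (z ∸ W)) base ⟩
  E * (4 ^ (2 * l) ∸ W)        ∎
  where
  l E W : ℕ
  l = suc l′
  E = 2 ^ (j * (2 * l ∸ 1))
  W = 2 ^ (2 * l)
  k : ∀ W → W * W + 3 * W * 0 ≡ W * W
  k = ringℕ
  base : S 4 l (+ 1) * 3 + W ≡ 4 ^ (2 * l)
  base = begin
    S 4 l (+ 1) * 3 + W              ≡⟨ S-4 l (+ 1) refl (δ-true 2 (+ 2) ∣ℤ-refl) ⟩
    W * W + 3 * W * S 4 0 (+ 1)      ≡⟨ cong (λ z → W * W + 3 * W * z) (S₀-plus 4 2^2∤2) ⟩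
    W * W + 3 * W * 0                ≡⟨ k W ⟩
    W * W                            ≡⟨ 4^≡ (2 * l) ⟨
    4 ^ (2 * l)                      ∎

S-minus-2 : ∀ l′ j → let l = suc l′ ; n = 2 * l ; D = 2 ^ (n ∸ 1 ∸ l) ∸ 1 in
  S (2 ^ (2 + j)) l (- + 1) * (3 * D) ≡ 2 ^ (j * (n ∸ 1)) * (4 ^ n + 2 ^ (n + 1)) * D
    + (2 ^ (j * (n ∸ 1 ∸ l)) ∸ 1) * 2 ^ ((2 + j) * l ∸ 1) * 3
S-minus-2 l′ j = begin
  s * (3 * D)                            ≡⟨ k₁ s D ⟩
  s * D * 3                              ≡⟨ cong (_* 3) (S-minus-closed prime[2] l′ 1 j) ⟩
  (E * s₀ * D + b * (g * 1)) * 3         ≡⟨ k₂ E s₀ D b g ⟩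
  E * (s₀ * 3) * D + b * g * 3           ≡⟨ cong (λ z → E * z * D + b * g * 3) base ⟩
  E * (4 ^ n + 2 ^ (n + 1)) * D + b * g * 3 ∎
  where
  l n D s s₀ E b g W : ℕ
  l = suc l′
  n = 2 * l
  D = 2 ^ (n ∸ 1 ∸ l) ∸ 1
  s = S (2 ^ (2 + j)) l (- + 1)
  s₀ = S 4 l (- + 1)
  E = 2 ^ (j * (n ∸ 1))
  b = 2 ^ (j * (n ∸ 1 ∸ l)) ∸ 1
  g = 2 ^ ((2 + j) * l ∸ 1)
  W = 2 ^ n
  k₁ : ∀ s D → s * (3 * D) ≡ s * D * 3
  k₁ = ringℕ
  k₂ : ∀ E s D b g → (E * s * D + b * (g * 1)) * 3 ≡ E * (s * 3) * D + b * g * 3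
  k₂ = ringℕ
  k₃ : ∀ W → W * W + 3 * W * 1 ≡ W * W + W * 2 + W
  k₃ = ringℕ
  base : s₀ * 3 ≡ 4 ^ n + 2 ^ (n + 1)
  base = +-cancelʳ-≡ W _ _ (begin
    s₀ * 3 + W                        ≡⟨ S-4 l (- + 1) refl (S₀-minus 2) ⟩
    W * W + 3 * W * S 4 0 (- + 1)     ≡⟨ cong (λ z → W * W + 3 * W * z) (S₀-minus 4) ⟩
    W * W + 3 * W * 1                 ≡⟨ k₃ W ⟩
    W * W + W * 2 + W                 ≡⟨ cong₂ (λ y z → y + z + W) (4^≡ n) (^-distribˡ-+-* 2 n 1) ⟨
    4 ^ n + 2 ^ (n + 1) + W           ∎)

sgn-even : ∀ l → 2 ∣ l → sgn l ≡ + 1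
sgn-even _ (divides zero refl) = refl
sgn-even _ (divides (suc k) refl) = trans (ℤP.neg-involutive _) (sgn-even (k * 2) (divides k refl))

sgn-odd : ∀ l → ¬ 2 ∣ l → sgn l ≡ - + 1
sgn-odd zero h = ⊥-elim (h (divides 0 refl))
sgn-odd (suc zero) h = refl
sgn-odd (suc (suc l)) h = trans (ℤP.neg-involutive _) (sgn-odd l (h ∘ 2∣2+))
  where
  2∣2+ : 2 ∣ l → 2 ∣ 2 + l
  2∣2+ (divides k refl) = divides (suc k) refl

w≡S : ∀ N .{{_ : NonZero N}} l ε v → ε ℤ.* ε ≡ + 1 → sgn l ℤ.* v ≡ ε → w N (2 * l + 2) ε ε ≡ S N l v
w≡S N l ε v ε² refl = w≡F N (sgn l ℤ.* v) ε² (2 * l)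

by-parity : ∀ N .{{_ : NonZero N}} l (small big : ℕ → Set) → small (S N l (+ 1)) → big (S N l (- + 1)) →
  ((2 ∣ l) → small (w⁺ N (2 * l + 2)) × big (w⁻ N (2 * l + 2)))
  × ((¬ (2 ∣ l)) → big (w⁺ N (2 * l + 2)) × small (w⁻ N (2 * l + 2)))
by-parity N l small big s b =
  (λ even → let e = sgn-even l even in
    subst small (sym (w≡S N l (+ 1) (+ 1) refl (cong (ℤ._* + 1) e))) s ,
    subst big (sym (w≡S N l (- + 1) (- + 1) refl (cong (ℤ._* - + 1) e))) b) ,
  (λ odd → let e = sgn-odd l odd in
    subst big (sym (w≡S N l (+ 1) (- + 1) refl (cong (ℤ._* - + 1) e))) b ,
    subst small (sym (w≡S N l (- + 1) (+ 1) refl (cong (ℤ._* + 1) e))) s)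

theorem1p4 :
  -- (i) p an odd prime, m ≥ 2, n = 2l ≥ 4 (divisions cleared; see NOTES.md)
  ((p m l : ℕ) → (pr : Prime p) → ¬ (2 ∣ p) → 2 ≤ m → 2 ≤ l →
    let nz = m^n≢0 p m {{prime⇒nonZero pr}}
        n = 2 * l
        E = p ^ ((m ∸ 1) * (n ∸ 1))
        A = (p ^ (l + 1) ∸ 1) * (p ^ l ∸ 1)
        D = p ^ (n ∸ 1 ∸ l) ∸ 1
        B = (p ^ ((m ∸ 1) * (n ∸ 1 ∸ l)) ∸ 1) * (p ^ (m * l ∸ 1) * (p ∸ 1))
        small = λ (x : ℕ) → x * (p ^ 2 ∸ 1) ≡ E * A
        big = λ (x : ℕ) → x * ((p ^ 2 ∸ 1) * D)
                          ≡ E * (A + p ^ l * (p ^ 2 ∸ 1)) * D + B * (p ^ 2 ∸ 1)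
    in ((2 ∣ l) → small (w⁺ (p ^ m) {{nz}} (n + 2)) × big (w⁻ (p ^ m) {{nz}} (n + 2)))
     × ((¬ (2 ∣ l)) → big (w⁺ (p ^ m) {{nz}} (n + 2)) × small (w⁻ (p ^ m) {{nz}} (n + 2))))
  ×
  -- (ii) m ≥ 3, n = 2l ≥ 4, modulus 2^m
  ((m l : ℕ) → 3 ≤ m → 2 ≤ l →
    let nz = m^n≢0 2 m
        n = 2 * l
        E = 2 ^ ((m ∸ 2) * (n ∸ 1))
        D = 2 ^ (n ∸ 1 ∸ l) ∸ 1
        B = (2 ^ ((m ∸ 2) * (n ∸ 1 ∸ l)) ∸ 1) * 2 ^ (m * l ∸ 1)
        small = λ (x : ℕ) → x * 3 ≡ E * (4 ^ n ∸ 2 ^ n)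
        big = λ (x : ℕ) → x * (3 * D) ≡ E * (4 ^ n + 2 ^ (n + 1)) * D + B * 3
    in ((2 ∣ l) → small (w⁺ (2 ^ m) {{nz}} (n + 2)) × big (w⁻ (2 ^ m) {{nz}} (n + 2)))
     × ((¬ (2 ∣ l)) → big (w⁺ (2 ^ m) {{nz}} (n + 2)) × small (w⁻ (2 ^ m) {{nz}} (n + 2))))
theorem1p4 =
  (λ { zero m l pr _ _ _ → ⊥-elim (¬prime[0] pr)
     ; (suc r) (suc j) (suc l′) pr 2∤p _ _ →
         let p = suc r ; m = suc j ; l = suc l′ ; n = 2 * l
             E = p ^ ((m ∸ 1) * (n ∸ 1))
             A = (p ^ (l + 1) ∸ 1) * (p ^ l ∸ 1)
             D = p ^ (n ∸ 1 ∸ l) ∸ 1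
             B = (p ^ ((m ∸ 1) * (n ∸ 1 ∸ l)) ∸ 1) * (p ^ (m * l ∸ 1) * (p ∸ 1))
         in by-parity (p ^ m) {{m^n≢0 p m}} l
              (λ x → x * (p ^ 2 ∸ 1) ≡ E * A)
              (λ x → x * ((p ^ 2 ∸ 1) * D) ≡ E * (A + p ^ l * (p ^ 2 ∸ 1)) * D + B * (p ^ 2 ∸ 1))
              (S-plus-odd pr l′ 2∤p j) (S-minus-all pr l′ j) }) ,
  (λ { (suc zero) l (s≤s ()) _
     ; (suc (suc j)) (suc l′) _ _ →
         let m = 2 + j ; l = suc l′ ; n = 2 * l
             E = 2 ^ ((m ∸ 2) * (n ∸ 1))
             D = 2 ^ (n ∸ 1 ∸ l) ∸ 1
             B = (2 ^ ((m ∸ 2) * (n ∸ 1 ∸ l)) ∸ 1) * 2 ^ (m * l ∸ 1)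
         in by-parity (2 ^ m) {{m^n≢0 2 m}} l
              (λ x → x * 3 ≡ E * (4 ^ n ∸ 2 ^ n))
              (λ x → x * (3 * D) ≡ E * (4 ^ n + 2 ^ (n + 1)) * D + B * 3)
              (S-plus-2 l′ j) (S-minus-2 l′ j) })
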